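{- 3-SAT is polynomial time reducible to the decision problem MinCore$_{\mathrm{radius}}$: given a hypergraph $H$ and a positive integer $k$, is there a minimum core of $H$ with radius $\leq k$?
   Context: A hypergraph $H=(V,E)$ consists of a finite set $V$ (vertices) and a finite family $E$ of subsets of $V$ (edges). A core of $H$ is a set $C\subseteq V$ causing the following program to output $1$: (1) Remove all edges $e\in E$ with $e\subseteq C$. (2) While $E$ is non-empty: (a) if there exists $e\in E$ with $|e\cap C|=|e|-1$, set $C:=C\cup e$; (b) else return $0$; (c) remove all edges $e\in E$ with $e\cap C=e$. (3) Return $1$. In addition every vertex of $V$ has to lie in the final set $C$ (every vertex gets activated). A minimum core is a core of minimum cardinality. The radius $r(C)$ of a core $C$ is the minimum $r$ such that $E$ can be subdivided into $r$ disjoint layers $L_1,\dots,L_r$ such that $|e\cap V_{i-1}|=|e|-1$ for all $e\in L_i$, where $V_i:=C\cup\bigcup_{j=1}^{i}V(L_j)$ and $V(L_j)$ is the union of the edges in $L_j$. 3-SAT: given a Boolean formula in conjunctive normal form in which every clause contains exactly three literals, decide whether it is satisfiable. -}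

module Defs where

open import Data.Bool.Base using (Bool; true; false)
open import Data.Fin.Base using (Fin; zero; toℕ)
open import Data.Fin.Properties using (toℕ-injective)
open import Data.Fin.Subset using (Subset; _∩_; _∪_; ∣_∣; ⊤; ⋃)
open import Data.Fin.Subset.Properties using (_⊆?_)
open import Data.List.Base as List using (List; []; _∷_; _++_; length; filter; allFin)
open import Data.List.Membership.Propositional using (_∈_)
open import Data.List.Properties using (∷-injective; ++-assoc)
open import Data.Maybe.Base using (Maybe)
open import Data.Nat.Base using (ℕ; zero; suc; _+_; _*_; _^_; _≤_; NonZero)
open import Data.Nat.Binary.Base using (ℕᵇ; zero; 2[1+_]; 1+[2_]; fromℕ)
open import Data.Nat.Binary.Properties using (fromℕ-injective)
open import Data.Nat.Properties using (_≟_)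
open import Data.Product.Base using (Σ; ∃; ∃-syntax; _×_; _,_; proj₁; proj₂)
open import Data.Vec.Base as Vec using (Vec; []; _∷_; lookup; replicate; toList; _[_]%=_)
open import Data.Vec.Relation.Unary.Any using (Any)
open import Function.Bundles using (_⇔_)
open import Relation.Binary.PropositionalEquality
  using (_≡_; _≢_; refl; sym; trans; cong)
open import Relation.Nullary using (¬_; ¬?)

------------------------------------------------------------------------
-- Polynomial time

-- Programs over a fixed number s of stacks of bits, with finite control.
-- A stack is half of a Turing machine tape (its head is the cell scanned), and
-- every unit of cost inspects or changes the top of one stack, so running times
-- agree with those of multitape Turing machines up to a constant factor.

-- A test inspects the top of a stack (nothing if the stack is empty).
Test : Set
Test = Maybe Bool → Bool

infixr 5 _⨾_

data Program (s : ℕ) : Set where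
  push   : Fin s → Bool → Program s
  pop    : Fin s → Program s
  _⨾_    : Program s → Program s → Program s
  ifᵗ    : Fin s → Test → Program s → Program s → Program s
  whileᵗ : Fin s → Test → Program s → Program s

Store : ℕ → Set
Store s = Vec (List Bool) s

test : ∀ {s} → Store s → Fin s → Test → Bool
test σ i φ = φ (List.head (lookup σ i))

-- ⟨ p , σ ⟩⇓[ t ] τ : started in σ, p halts in τ after t steps.
-- Popping an empty stack has no effect.
data ⟨_,_⟩⇓[_]_ {s : ℕ} : Program s → Store s → ℕ → Store s → Set where
  push⇓   : ∀ {σ i b} → ⟨ push i b , σ ⟩⇓[ 1 ] (σ [ i ]%= (b ∷_))
  pop⇓    : ∀ {σ i} → ⟨ pop i , σ ⟩⇓[ 1 ] (σ [ i ]%= List.drop 1)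
  seq⇓    : ∀ {p q σ τ υ t u} →
            ⟨ p , σ ⟩⇓[ t ] τ → ⟨ q , τ ⟩⇓[ u ] υ →
            ⟨ p ⨾ q , σ ⟩⇓[ t + u ] υ
  then⇓   : ∀ {i φ p q σ τ t} → test σ i φ ≡ true →
            ⟨ p , σ ⟩⇓[ t ] τ → ⟨ ifᵗ i φ p q , σ ⟩⇓[ suc t ] τ
  else⇓   : ∀ {i φ p q σ τ t} → test σ i φ ≡ false →
            ⟨ q , σ ⟩⇓[ t ] τ → ⟨ ifᵗ i φ p q , σ ⟩⇓[ suc t ] τ
  exit⇓   : ∀ {i φ p σ} → test σ i φ ≡ false →
            ⟨ whileᵗ i φ p , σ ⟩⇓[ 1 ] σ
  repeat⇓ : ∀ {i φ p σ τ υ t u} → test σ i φ ≡ true →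
            ⟨ p , σ ⟩⇓[ t ] τ → ⟨ whileᵗ i φ p , τ ⟩⇓[ u ] υ →
            ⟨ whileᵗ i φ p , σ ⟩⇓[ suc (t + u) ] υ

-- The input is the content of stack 0 (top first), all other stacks are empty;
-- the output is read from stack 0.
Computes : ∀ {s} → Program (suc s) → List Bool → ℕ → List Bool → Set
Computes {s} p x t y =
  ∃[ τ ] ⟨ p , x ∷ replicate s [] ⟩⇓[ t ] τ × lookup τ zero ≡ y

record Problem : Set₁ where
  field
    Instance         : Set
    encode           : Instance → List Bool
    encode-injective : ∀ {x y} → encode x ≡ encode y → x ≡ y
    Yes              : Instance → Set

module _ (P Q : Problem) where
  private
    module P = Problem P
    module Q = Problem Q

  PolyTime : (P.Instance → Q.Instance) → Set
  PolyTime f =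
    Σ ℕ λ s → Σ (Program (suc s)) λ p → ∃[ c ] ∃[ d ]
      ∀ x → ∃[ t ] t ≤ c * length (P.encode x) ^ d + c
                 × Computes p (P.encode x) t (Q.encode (f x))

  infix 4 _≤ₚ_

  _≤ₚ_ : Set
  _≤ₚ_ = ∃[ f ] PolyTime f × (∀ x → P.Yes x ⇔ Q.Yes (f x))

------------------------------------------------------------------------
-- Encodings

-- Prefix codes: a codeword can be read off the front of any bit string.
record Code (A : Set) : Set where
  field
    enc    : A → List Bool
    cancel : ∀ x y {r s} → enc x ++ r ≡ enc y ++ s → x ≡ y × r ≡ s

  enc-injective : ∀ {x y} → enc x ≡ enc y → x ≡ y
  enc-injective {x} {y} eq = proj₁ (cancel x y (cong (_++ []) eq))

open Code

bitCode : Code Bool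
bitCode .enc b = b ∷ []
bitCode .cancel _ _ = ∷-injective

-- Sizes and names of variables are written in unary.  Since the number of
-- variables (or vertices) is part of the instance size anyway, this changes
-- lengths only polynomially.
unary : ℕ → List Bool
unary zero    = false ∷ []
unary (suc n) = true ∷ unary n

unaryCode : Code ℕ
unaryCode .enc = unary
unaryCode .cancel zero    zero    refl = refl , refl
unaryCode .cancel (suc m) (suc n) eq
  with refl , eq′ ← cancel unaryCode m n (proj₂ (∷-injective eq)) = refl , eq′

finCode : ∀ {n} → Code (Fin n)
finCode .enc i = unary (toℕ i)
finCode .cancel i j eq with i≡j , eq′ ← cancel unaryCode (toℕ i) (toℕ j) eq
  = toℕ-injective i≡j , eq′

module _ {A : Set} {B : A → Set} (c : Code A) (d : ∀ {a} → Code (B a)) where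

  ΣCode : Code (Σ A B)
  ΣCode .enc (a , b) = enc c a ++ enc d b
  ΣCode .cancel (a , b) (a′ , b′) {r} {s} eq
    with refl , eq₁ ← cancel c a a′ (trans (sym (++-assoc (enc c a) (enc d b) r))
                                    (trans eq (++-assoc (enc c a′) (enc d b′) s)))
    with refl , eq₂ ← cancel d b b′ eq₁ = refl , eq₂

module _ {A : Set} (c : Code A) where

  encVec : ∀ {n} → Vec A n → List Bool
  encVec []       = []
  encVec (x ∷ xs) = enc c x ++ encVec xs

  vecCode : ∀ {n} → Code (Vec A n)
  vecCode .enc = encVec
  vecCode .cancel [] [] eq = refl , eq
  vecCode .cancel (x ∷ xs) (y ∷ ys) {r} {s} eq
    with refl , eq₁ ← cancel c x y (trans (sym (++-assoc (enc c x) (encVec xs) r))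
                                   (trans eq (++-assoc (enc c y) (encVec ys) s)))
    with refl , eq₂ ← cancel vecCode xs ys eq₁ = refl , eq₂

mapCode : ∀ {A B : Set} (f : A → B) → (∀ {x y} → f x ≡ f y → x ≡ y) → Code B → Code A
mapCode f inj c .enc x = enc c (f x)
mapCode f inj c .cancel x y eq with fx≡fy , eq′ ← cancel c (f x) (f y) eq
  = inj fx≡fy , eq′

-- Binary notation, least significant digit first, with digits 1 (false) and
-- 2 (true) in place of 0 and 1, so that every bit string denotes one number.
-- It is not a prefix code.
bits : ℕᵇ → List Bool
bits zero     = []
bits 2[1+ x ] = true ∷ bits x
bits 1+[2 x ] = false ∷ bits x

bits-injective : ∀ x y → bits x ≡ bits y → x ≡ y
bits-injective zero     zero     _  = refl
bits-injective 2[1+ x ] 2[1+ y ] eq = cong 2[1+_] (bits-injective x y (proj₂ (∷-injective eq)))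
bits-injective 1+[2 x ] 1+[2 y ] eq = cong 1+[2_] (bits-injective x y (proj₂ (∷-injective eq)))

binary : ℕ → List Bool
binary n = bits (fromℕ n)

binary-injective : ∀ {m n} → binary m ≡ binary n → m ≡ n
binary-injective {m} {n} eq =
  fromℕ-injective (bits-injective (fromℕ m) (fromℕ n) eq)

------------------------------------------------------------------------
-- 3-SAT

-- (true , x) is the literal x and (false , x) its negation.
Literal : ℕ → Set
Literal n = Bool × Fin n

Clause : ℕ → Set
Clause n = Vec (Literal n) 3

record Formula : Set where
  constructor formula
  field
    #vars    : ℕ
    #clauses : ℕ
    clauses  : Vec (Clause #vars) #clauses

module _ {n : ℕ} (α : Fin n → Bool) where

  LiteralTrue : Literal n → Set
  LiteralTrue (b , x) = α x ≡ b

  ClauseTrue : Clause n → Set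
  ClauseTrue = Any LiteralTrue

Satisfiable : Formula → Set
Satisfiable φ = Σ (Fin #vars → Bool) λ α → ∀ j → ClauseTrue α (lookup clauses j)
  where open Formula φ

literalCode : ∀ {n} → Code (Literal n)
literalCode = ΣCode bitCode finCode

clauseCode : ∀ {n} → Code (Clause n)
clauseCode = vecCode literalCode

formulaCode : Code Formula
formulaCode = mapCode (λ φ → let open Formula φ in #vars , #clauses , clauses)
  (λ { refl → refl })
  (ΣCode unaryCode (ΣCode unaryCode (vecCode clauseCode)))

ThreeSAT : Problem
ThreeSAT = record
  { Instance         = Formula
  ; encode           = enc formulaCode
  ; encode-injective = enc-injective formulaCode
  ; Yes              = Satisfiable
  }

------------------------------------------------------------------------
-- Hypergraphs, cores and the radius

-- The edges form a family, so an edge may occur several times.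
record Hypergraph : Set where
  constructor hypergraph
  field
    #vertices : ℕ
    #edges    : ℕ
    edges     : Vec (Subset #vertices) #edges

-- |e ∩ C| = |e| - 1 without truncated subtraction, so that it fails for e = ∅.
OneMissing : ∀ {n} → Subset n → Subset n → Set
OneMissing e C = suc ∣ e ∩ C ∣ ≡ ∣ e ∣

removeContained : ∀ {n} → Subset n → List (Subset n) → List (Subset n)
removeContained C = filter (λ e → ¬? (e ⊆? C))

-- Loop C E b D : some run of the while loop from C and E returns b (true for 1)
-- and leaves D as the final set.
data Loop {n : ℕ} : Subset n → List (Subset n) → Bool → Subset n → Set where
  return1 : ∀ {C} → Loop C [] true C
  return0 : ∀ {C E} → E ≢ [] → (∀ {e} → e ∈ E → ¬ OneMissing e C) → Loop C E false C
  iterate : ∀ {C E b D e} → e ∈ E → OneMissing e C →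
            Loop (C ∪ e) (removeContained (C ∪ e) E) b D → Loop C E b D

module _ (H : Hypergraph) where
  open Hypergraph H

  -- The choices made in the loop affect neither the value returned nor, when it
  -- is 1, the final set: C only grows, so an edge with one missing vertex keeps
  -- being applicable until that vertex has been activated.
  IsCore : Subset #vertices → Set
  IsCore C = Loop C (removeContained C (toList edges)) true ⊤

  IsMinimumCore : Subset #vertices → Set
  IsMinimumCore C = IsCore C × (∀ D → IsCore D → ∣ C ∣ ≤ ∣ D ∣)

  module _ (C : Subset #vertices) {r : ℕ} (layer : Vec (Fin r) #edges) where

    -- The union of the edges in layer i; layers are numbered from 0 here.
    layerVertices : ℕ → Subset #vertices
    layerVertices i =
      ⋃ (List.map (lookup edges) (filter (λ j → toℕ (lookup layer j) ≟ i) (allFin #edges)))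

    V : ℕ → Subset #vertices
    V zero    = C
    V (suc i) = V i ∪ layerVertices i

    IsLayering : Set
    IsLayering = ∀ j → OneMissing (lookup edges j) (V (toℕ (lookup layer j)))

  -- Layers may be empty, but never are for the least r.
  HasLayering : Subset #vertices → ℕ → Set
  HasLayering C r = Σ (Vec (Fin r) #edges) (IsLayering C)

  -- Without any layering the radius is undefined.
  IsRadius : Subset #vertices → ℕ → Set
  IsRadius C r = HasLayering C r × (∀ r′ → HasLayering C r′ → r ≤ r′)

record MinCoreInstance : Set where
  constructor minCoreInstance
  field
    H          : Hypergraph
    k          : ℕ
    .{{k-pos}} : NonZero k

HasMinimumCoreOfRadius≤ : MinCoreInstance → Set
HasMinimumCoreOfRadius≤ I =
  ∃[ C ] IsMinimumCore H C × (∃[ r ] IsRadius H C r × r ≤ k)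
  where open MinCoreInstance I

-- A hypergraph is encoded by its incidence matrix.
hypergraphCode : Code Hypergraph
hypergraphCode = mapCode (λ H → let open Hypergraph H in #vertices , #edges , edges)
  (λ { refl → refl })
  (ΣCode unaryCode (ΣCode unaryCode (vecCode (vecCode bitCode))))

MinCoreRadius : Problem
MinCoreRadius = record
  { Instance         = MinCoreInstance
  ; encode           = λ (minCoreInstance H k) → enc hypergraphCode H ++ binary k
  ; encode-injective = λ { {minCoreInstance H k} {minCoreInstance H′ k′} → injective H k H′ k′ }
  ; Yes              = HasMinimumCoreOfRadius≤
  }
  where
  injective : ∀ H k H′ k′ .{{_ : NonZero k}} .{{_ : NonZero k′}} →
    enc hypergraphCode H ++ binary k ≡ enc hypergraphCode H′ ++ binary k′ →
    minCoreInstance H k ≡ minCoreInstance H′ k′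
  injective H k H′ k′ eq with refl , eq′ ← cancel hypergraphCode H H′ eq
    with refl ← binary-injective {k} {k′} eq′ = refl

{-# OPTIONS --safe #-}
module Submission where

-- Edges with one vertex make ∅ the only minimum core of the hypergraph H below, so that only
-- layerings from ∅ matter.  The vertices of H are the literals, a vertex cⱼ for every clause and
-- one more vertex, the apex.  The edges are {l} for every literal l, {x, ¬ x} for every variable
-- x, {l, cⱼ} for every literal l of clause j, and {apex, c₁, …, cₘ}.
--   A satisfying assignment yields three layers: the first activates the true literals, the
-- second the cⱼ, the third the false literals and the apex.  Conversely, take a layering with
-- at most three layers.  The apex lies on one edge only, so all cⱼ are active before the layer of
-- that edge, hence after two layers.  Only literals are activated by the first layer, so cⱼ is
-- activated in the second, by an edge {l, cⱼ} with l active after the first layer.  The edges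
-- {x, ¬ x} prevent x and ¬ x from both being active then.
--   H is printed in reverse by a program in which the number of repetitions of every loop is at
-- most the length of the input; a second program reverses the output.

open import Defs

open import Data.Bool.Base using (Bool; true; false; not; _∨_)
open import Data.Bool.Properties using (¬-not; not-¬) renaming (_≟_ to _≟ᵇ_)
open import Data.Fin.Base using (Fin; zero; suc; toℕ; combine; splitAt; _↑ˡ_; _↑ʳ_)
open import Data.Fin.Patterns using (0F; 1F; 2F; 3F; 4F; 5F; 6F)
open import Data.Fin.Properties
  using (any?; toℕ<n; combine-injective; combine-surjective; ↑ˡ-injective; ↑ʳ-injective;
         splitAt-↑ˡ; splitAt-↑ʳ; join-splitAt)
  renaming (_≟_ to _≟ᶠ_; all? to allᶠ?; suc-injective to sucᶠ-injective)
open import Data.Fin.Subset using (Subset; _∈_; _∉_; _⊆_; _∩_; _∪_; ∣_∣; ⊥; ⊤; ⁅_⁆; ⋃)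
open import Data.Fin.Subset.Properties
  using (_∈?_; _⊆?_; ∉⊥; p⊆p∪q; q⊆p∪q; x∈p∪q⁻; ∣⊥∣≡0; drop-∷-⊆; drop-there;
         ⊆⊤; ⊆-antisym; ∣p∩q∣≤∣p∣; x∈⁅x⁆; x∈⁅y⁆⇒x≡y;
         ∪-idem; ∪-identityˡ; ∪-identityʳ)
open import Data.List.Base as List
  using (List; []; _∷_; [_]; _++_; _ʳ++_; length; filter; allFin; drop)
open import Data.List.Membership.Propositional using () renaming (_∈_ to _∈ₗ_)
open import Data.List.Membership.Propositional.Properties
  using (∈-filter⁺; ∈-filter⁻; ∈-allFin) renaming (∈-map⁺ to ∈ₗ-map⁺; ∈-map⁻ to ∈ₗ-map⁻)
open import Data.List.Properties
  using (filter-notAll; ++-ʳ++; ʳ++-ʳ++; ++-assoc; ++-identityʳ; length-++; length-drop)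
open import Data.List.Relation.Unary.Any as AnyL using (here; there)
open import Data.Maybe.Base using (just; nothing)
open import Data.Nat using (_≤′_; ≤′-refl; ≤′-step)
open import Data.Nat.Base
  using (ℕ; zero; suc; _+_; _*_; _^_; _∸_; _≤_; _<_; z≤n; s≤s; s≤s⁻¹)
open import Data.Nat.Induction using (<-wellFounded)
open import Data.Nat.Properties
  using (*-identityʳ; *-mono-≤; *-monoʳ-≤; *-monoˡ-≤; +-assoc; +-comm; +-identityʳ;
         +-mono-≤; +-monoʳ-≤; +-suc; <-asym; <-irrefl; <-≤-trans; <⇒≤;
         [m*n]*[o*p]≡[m*o]*[n*p]; ^-distribˡ-+-*; ^-monoʳ-≤; ^-monoˡ-≤; m∸n+n≡m; m∸n≤m;
         m≤m+n; m≤n+m; m≤n⇒m≤1+n; n≤0⇒n≡0; n≤1+n; suc-injective; ≤-refl; ≤-reflexive;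
         ≤-trans; ≤⇒≤′; ≰⇒>; _≟_; module ≤-Reasoning)
open import Data.Product.Base using (∃; ∃-syntax; _×_; _,_; proj₁; proj₂)
open import Data.Sum.Base using (_⊎_; inj₁; inj₂; [_,_]′)
open import Data.Vec.Base as Vec
  using (Vec; []; _∷_; lookup; tabulate; concat; toList; here; there; _[_]%=_)
open import Data.Vec.Membership.Propositional using () renaming (_∈_ to _∈ᵛ_)
open import Data.Vec.Membership.Propositional.Properties
  using (∈-lookup; ∈-toList⁺; ∈-map⁺; ∈-++⁺ˡ; ∈-++⁺ʳ)
open import Data.Vec.Properties
  using ([]=⇒lookup; lookup⇒[]=; lookup-replicate; lookup-++ˡ; lookup-++ʳ; lookup∘tabulate;
         lookup∘updateAt; lookup∘updateAt′; zipWith-++)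
open import Data.Vec.Relation.Unary.All using ([]; _∷_)
import Data.Vec.Relation.Unary.All.Properties as AllVₚ
open import Data.Vec.Relation.Unary.Any as AnyV using (here; there)
import Data.Vec.Relation.Unary.Any.Properties as AnyVₚ
open import Function.Base using (_∘_; id)
open import Function.Bundles using (_⇔_; mk⇔)
open import Induction.WellFounded using (Acc; acc)
open import Relation.Binary.PropositionalEquality
  using (_≡_; _≢_; refl; sym; trans; cong; cong₂; subst; subst₂; module ≡-Reasoning)
open import Relation.Nullary
  using (¬_; ¬?; Dec; yes; no; contradiction; _×-dec_; decidable-stable)
open import Relation.Nullary.Decidable using (map′)
open import Relation.Unary using (Decidable)

-- Cores and layerings

∣∩∣-⊇ : ∀ {n} (e C : Subset n) → e ⊆ C → ∣ e ∩ C ∣ ≡ ∣ e ∣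
∣∩∣-⊇ [] [] _ = refl
∣∩∣-⊇ (false ∷ e) (c ∷ C) e⊆C = ∣∩∣-⊇ e C (drop-∷-⊆ e⊆C)
∣∩∣-⊇ (true ∷ e) (c ∷ C) e⊆C with here ← e⊆C here = cong suc (∣∩∣-⊇ e C (drop-∷-⊆ e⊆C))

∣∩∣-⊇⁻ : ∀ {n} (e C : Subset n) → ∣ e ∩ C ∣ ≡ ∣ e ∣ → e ⊆ C
∣∩∣-⊇⁻ (false ∷ e) (c ∷ C) eq (there x∈e) = there (∣∩∣-⊇⁻ e C eq x∈e)
∣∩∣-⊇⁻ (true ∷ e) (true ∷ C) eq here = here
∣∩∣-⊇⁻ (true ∷ e) (true ∷ C) eq (there x∈e) = there (∣∩∣-⊇⁻ e C (suc-injective eq) x∈e)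
∣∩∣-⊇⁻ (true ∷ e) (false ∷ C) eq x∈e =
  contradiction (subst (_≤ ∣ e ∣) eq (∣p∩q∣≤∣p∣ e C)) (<-irrefl refl)

-- With its converse `oneMissing⁻` this replaces the cardinality condition by a single missing
-- vertex, the form that suits arguments about edges.
oneMissing⁺ : ∀ {n} {e C : Subset n} {v} → v ∈ e → v ∉ C →
              (∀ {u} → u ∈ e → u ≢ v → u ∈ C) → OneMissing e C
oneMissing⁺ {e = true ∷ e} {true ∷ C} here v∉C _ = contradiction here v∉C
oneMissing⁺ {e = true ∷ e} {false ∷ C} here _ rest =
  cong suc (∣∩∣-⊇ e C λ u∈e → drop-there (rest (there u∈e) λ ()))
oneMissing⁺ {e = b ∷ e} {c ∷ C} {suc v} (there v∈e) v∉C rest = extend b c rest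
  where
  tail : OneMissing e C
  tail = oneMissing⁺ v∈e (v∉C ∘ there) λ u∈e u≢v →
    drop-there (rest (there u∈e) (u≢v ∘ sucᶠ-injective))
  extend : ∀ b c → (∀ {u} → u ∈ b ∷ e → u ≢ suc v → u ∈ c ∷ C) → OneMissing (b ∷ e) (c ∷ C)
  extend false _     _    = tail
  extend true  true  _    = cong suc tail
  extend true  false rest = contradiction (rest here λ ()) λ ()

oneMissing⁻ : ∀ {n} (e C : Subset n) → OneMissing e C →
              ∃[ v ] v ∈ e × v ∉ C × (∀ {u} → u ∈ e → u ∉ C → u ≡ v)
oneMissing⁻ (true ∷ e) (false ∷ C) eq = zero , here , (λ ()) , unique
  where
  unique : ∀ {u} → u ∈ true ∷ e → u ∉ false ∷ C → u ≡ zero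
  unique here _ = refl
  unique (there u∈e) u∉C = contradiction (there (∣∩∣-⊇⁻ e C (suc-injective eq) u∈e)) u∉C
oneMissing⁻ (true ∷ e) (true ∷ C) eq
  with v , v∈e , v∉C , unique ← oneMissing⁻ e C (suc-injective eq)
  = suc v , there v∈e , (λ { (there v∈C) → v∉C v∈C })
  , λ { here u∉C → contradiction here u∉C
      ; (there u∈e) u∉C → cong suc (unique u∈e (u∉C ∘ there)) }
oneMissing⁻ (false ∷ e) (c ∷ C) eq
  with v , v∈e , v∉C , unique ← oneMissing⁻ e C eq
  = suc v , there v∈e , (λ { (there v∈C) → v∉C v∈C })
  , λ { (there u∈e) u∉C → cong suc (unique u∈e (u∉C ∘ there)) }

module _ {n : ℕ} where

  ∈-⋃⁺ : ∀ {p : Subset n} {ps x} → p ∈ₗ ps → x ∈ p → x ∈ ⋃ ps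
  ∈-⋃⁺ {ps = q ∷ ps} (here refl) x∈p = p⊆p∪q (⋃ ps) x∈p
  ∈-⋃⁺ {ps = q ∷ ps} (there p∈ps) x∈p = q⊆p∪q q (⋃ ps) (∈-⋃⁺ p∈ps x∈p)

  ∈-⋃⁻ : ∀ (ps : List (Subset n)) {x} → x ∈ ⋃ ps → ∃[ p ] p ∈ₗ ps × x ∈ p
  ∈-⋃⁻ [] x∈ = contradiction x∈ ∉⊥
  ∈-⋃⁻ (p ∷ ps) x∈ with x∈p∪q⁻ p (⋃ ps) x∈
  ... | inj₁ x∈p = p , here refl , x∈p
  ... | inj₂ x∈⋃ with q , q∈ps , x∈q ← ∈-⋃⁻ ps x∈⋃ = q , there q∈ps , x∈q

module _ (H : Hypergraph) (C : Subset (Hypergraph.#vertices H)) {r : ℕ}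
         (layer : Vec (Fin r) (Hypergraph.#edges H)) where
  open Hypergraph H

  private
    W : ℕ → Subset #vertices
    W = V H C layer

  ∈-layer⇒∈-V : ∀ a {x} → x ∈ lookup edges a → x ∈ W (suc (toℕ (lookup layer a)))
  ∈-layer⇒∈-V a x∈e = q⊆p∪q _ _
    (∈-⋃⁺ (∈ₗ-map⁺ (lookup edges)
      (∈-filter⁺ (λ b → toℕ (lookup layer b) ≟ _) (∈-allFin a) refl)) x∈e)

  ∈-V-suc⁻ : ∀ i {x} → x ∈ W (suc i) →
             x ∈ W i ⊎ (∃[ a ] toℕ (lookup layer a) ≡ i × x ∈ lookup edges a)
  ∈-V-suc⁻ i x∈ with x∈p∪q⁻ (W i) _ x∈
  ... | inj₁ x∈W = inj₁ x∈W
  ... | inj₂ x∈L with p , p∈ , x∈p ← ∈-⋃⁻ _ x∈L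
    with a , a∈ , refl ← ∈ₗ-map⁻ (lookup edges) p∈
    = inj₂ (a , proj₂ (∈-filter⁻ (λ b → toℕ (lookup layer b) ≟ i) {xs = allFin #edges} a∈) , x∈p)

  V-mono : ∀ {i j} → i ≤ j → W i ⊆ W j
  V-mono i≤j = go (≤⇒≤′ i≤j)
    where
    go : ∀ {i j} → i ≤′ j → W i ⊆ W j
    go ≤′-refl x∈ = x∈
    go (≤′-step i≤j) x∈ = p⊆p∪q _ (go i≤j x∈)

-- `t` is read as a schedule of activation times: an edge topped by `v` can activate `v` at time
-- `t v`, its other vertices being active earlier.
Tops : ∀ {n} → (Fin n → ℕ) → Fin n → Subset n → Set
Tops t v e = v ∈ e × (∀ {u} → u ∈ e → u ≢ v → t u < t v)

module _ (H : Hypergraph) where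
  open Hypergraph H

  module _ (t : Fin #vertices → ℕ) (topped : ∀ v → ∃[ a ] Tops t v (lookup edges a)) where

    private
      -- The edge topped by an inactive vertex of least time is applicable.
      progress : ∀ C v → Acc _<_ (t v) → v ∉ C →
                 ∃[ a ] OneMissing (lookup edges a) C × ¬ (lookup edges a ⊆ C)
      progress C v (acc rs) v∉C with a , v∈e , below ← topped v
        with any? (λ u → u ∈? lookup edges a ×-dec (¬? (u ∈? C) ×-dec ¬? (u ≟ᶠ v)))
      ... | yes (u , u∈e , u∉C , u≢v) = progress C u (rs (below u∈e u≢v)) u∉C
      ... | no none = a , oneMissing⁺ v∈e v∉C others , λ e⊆C → v∉C (e⊆C v∈e)
        where
        others : ∀ {u} → u ∈ lookup edges a → u ≢ v → u ∈ C
        others {u} u∈e u≢v = decidable-stable (u ∈? C) λ u∉C → none (u , u∈e , u∉C , u≢v)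

      -- The last two hypotheses are the loop invariant. While a vertex is inactive, `progress`
      -- supplies an applicable edge, and `E` shrinks because that edge is contained in the new set.
      -- Once `E` is empty, an inactive vertex would contradict `complete` at the edge that it tops.
      run : ∀ C E → Acc _<_ (length E) →
            (∀ {e} → e ∈ₗ E → ¬ (e ⊆ C)) →
            (∀ a → ¬ (lookup edges a ⊆ C) → lookup edges a ∈ₗ E) →
            Loop C E true ⊤
      run C [] _ _ complete =
        subst (Loop C [] true) (⊆-antisym ⊆⊤ λ {v} _ → everywhere v) return1
        where
        everywhere : ∀ v → v ∈ C
        everywhere v with a , v∈e , _ ← topped v = decidable-stable (v ∈? C) λ v∉C →
          contradiction (complete a λ e⊆C → v∉C (e⊆C v∈e)) λ ()
      run C E@(e ∷ _) (acc rs) sound complete with any? (λ v → ¬? (v ∈? C))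
      -- All vertices are active, so the head of `E` is contained in `C`, against `sound`.
      ... | no none = contradiction
        (λ {v} _ → decidable-stable (v ∈? C) λ v∉C → none (v , v∉C)) (sound (here refl))
      ... | yes (v , v∉C) with a , missing , e⊈C ← progress C v (<-wellFounded _) v∉C =
        iterate a∈E missing
          (run C′ (removeContained C′ E) (rs shorter)
            (λ e∈ → proj₂ (∈-filter⁻ (λ e → ¬? (e ⊆? C′)) {xs = E} e∈))
            (λ b b⊈C′ → ∈-filter⁺ (λ e → ¬? (e ⊆? C′))
              (complete b λ b⊆C → b⊈C′ (p⊆p∪q _ ∘ b⊆C)) b⊈C′))
        where
        C′ = C ∪ lookup edges a
        a∈E = complete a e⊈C
        shorter : length (removeContained C′ E) < length E
        shorter = filter-notAll (λ e → ¬? (e ⊆? C′)) E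
          (AnyL.map (λ { refl e⊈C′ → e⊈C′ (q⊆p∪q C _) }) a∈E)

    topped⇒⊥-core : IsCore H ⊥
    topped⇒⊥-core = run ⊥ _ (<-wellFounded _)
      (λ e∈ → proj₂ (∈-filter⁻ (λ e → ¬? (e ⊆? ⊥)) {xs = toList edges} e∈))
      (λ a → ∈-filter⁺ (λ e → ¬? (e ⊆? ⊥)) (∈-toList⁺ (∈-lookup a edges)))

  module _ {r : ℕ} (t : Fin #vertices → Fin r)
           (topped : ∀ v → ∃[ a ] Tops (toℕ ∘ t) v (lookup edges a))
           (top : ∀ a → ∃[ v ] Tops (toℕ ∘ t) v (lookup edges a)) where

    private
      -- An edge is put in the layer given by its last vertex, so V i consists of the vertices of
      -- time less than i.
      layer : Vec (Fin r) #edges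
      layer = tabulate (t ∘ proj₁ ∘ top)

      -- Of two distinct tops of an edge each would be earlier than the other, so the choice made by
      -- `top` is the only one.
      layer-top : ∀ a {v} → Tops (toℕ ∘ t) v (lookup edges a) → lookup layer a ≡ t v
      layer-top a {v} (v∈e , below) with v ≟ᶠ proj₁ (top a)
      ... | yes refl = lookup∘tabulate (t ∘ proj₁ ∘ top) a
      ... | no v≢w with w∈e , below′ ← proj₂ (top a) =
        contradiction (below w∈e (v≢w ∘ sym)) (<-asym (below′ v∈e v≢w))

      V-sound : ∀ i {x} → x ∈ V H ⊥ layer i → toℕ (t x) < i
      V-sound zero x∈ = contradiction x∈ ∉⊥
      V-sound (suc i) {x} x∈ with ∈-V-suc⁻ H ⊥ layer i x∈
      ... | inj₁ x∈V = m≤n⇒m≤1+n (V-sound i x∈V)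
      ... | inj₂ (a , refl , x∈e) rewrite layer-top a (proj₂ (top a)) with x ≟ᶠ proj₁ (top a)
      ...   | yes refl = ≤-refl
      ...   | no x≢v = m≤n⇒m≤1+n (proj₂ (proj₂ (top a)) x∈e x≢v)

      V-complete : ∀ i {x} → toℕ (t x) < i → x ∈ V H ⊥ layer i
      V-complete i {x} tx<i with a , tops ← topped x =
        V-mono H ⊥ layer (subst (λ s → toℕ s < i) (sym (layer-top a tops)) tx<i)
          (∈-layer⇒∈-V H ⊥ layer a (proj₁ tops))

    -- Just before the layer of an edge, the active vertices are exactly those of smaller time than
    -- its top, hence all vertices of the edge but the top.
    topped⇒HasLayering : HasLayering H ⊥ r
    topped⇒HasLayering = layer , λ a → let v , v∈e , below = top a in
      subst (λ s → OneMissing (lookup edges a) (V H ⊥ layer (toℕ s)))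
        (sym (layer-top a (proj₂ (top a))))
        (oneMissing⁺ v∈e (λ v∈V → <-irrefl refl (V-sound _ v∈V))
          (λ u∈e u≢v → V-complete _ (below u∈e u≢v)))

anyVec? : ∀ {r} m {P : Vec (Fin r) m → Set} → Decidable P → Dec (∃ P)
anyVec? zero P? = map′ (λ p → [] , p) (λ { ([] , p) → p }) (P? [])
anyVec? (suc m) P? = map′ (λ (x , xs , p) → x ∷ xs , p) (λ { (x ∷ xs , p) → x , xs , p })
  (any? λ x → anyVec? m (λ xs → P? (x ∷ xs)))

least : ∀ {P : ℕ → Set} → Decidable P → ∀ n → P n →
        ∃[ m ] (P m × (∀ k → P k → m ≤ k)) × m ≤ n
least P? zero pn = zero , (pn , λ _ _ → z≤n) , z≤n
least P? (suc n) pn with P? zero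
... | yes p₀ = zero , (p₀ , λ _ _ → z≤n) , z≤n
... | no ¬p₀ with m , (pm , min) , m≤n ← least (P? ∘ suc) n pn =
  suc m , (pm , λ { zero p₀ → contradiction p₀ ¬p₀ ; (suc k) pk → s≤s (min k pk) }) , s≤s m≤n

-- There are finitely many assignments of layers to edges, so `HasLayering` is decidable for each
-- number of layers and the least number can be found by search from 0.
HasLayering⇒IsRadius : ∀ H C n → HasLayering H C n → ∃[ r ] IsRadius H C r × r ≤ n
HasLayering⇒IsRadius H C = least λ r → anyVec? #edges λ layer →
  allᶠ? λ a → suc ∣ lookup edges a ∩ V H C layer (toℕ (lookup layer a)) ∣ ≟ ∣ lookup edges a ∣
  where open Hypergraph H

-- The hypergraph of a formula

∣p∣≡0⇒p≡⊥ : ∀ {n} (p : Subset n) → ∣ p ∣ ≡ 0 → p ≡ ⊥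
∣p∣≡0⇒p≡⊥ [] _ = refl
∣p∣≡0⇒p≡⊥ (false ∷ p) eq = cong (false ∷_) (∣p∣≡0⇒p≡⊥ p eq)

oneMissing-unique : ∀ {n} {e C : Subset n} {u v} → OneMissing e C →
                    u ∈ e → v ∈ e → u ≢ v → u ∉ C → v ∈ C
oneMissing-unique {e = e} {C} {u} {v} missing u∈e v∈e u≢v u∉C
  with _ , _ , _ , unique ← oneMissing⁻ e C missing =
  decidable-stable (v ∈? C) λ v∉C → u≢v (trans (unique u∈e u∉C) (sym (unique v∈e v∉C)))

side : Bool → Fin 2
side true  = 0F
side false = 1F

↑ˡ≢↑ʳ : ∀ {m n} (i : Fin m) (j : Fin n) → i ↑ˡ n ≢ m ↑ʳ j
↑ˡ≢↑ʳ {m} {n} i j eq with () ← trans (sym (splitAt-↑ˡ m i n))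
  (trans (cong (splitAt m) eq) (splitAt-↑ʳ m n j))

module Reduction (φ : Formula) where
  open Formula φ renaming (#vars to n; #clauses to m)

  #V : ℕ
  #V = suc (n * 2 + m)

  data Vertex : Set where
    apex : Vertex
    lit  : Literal n → Vertex
    cls  : Fin m → Vertex

  -- Opaque so that x can be inferred from pt x.
  opaque

    -- The apex comes first, followed by x₀, ¬ x₀, x₁, ¬ x₁, … and then by the clauses.
    pt : Vertex → Fin #V
    pt apex          = zero
    pt (lit (b , i)) = suc (combine i (side b) ↑ˡ m)
    pt (cls j)       = suc ((n * 2) ↑ʳ j)

    name : ∀ v → ∃[ x ] pt x ≡ v
    name zero = apex , refl
    name (suc v) with splitAt (n * 2) v | join-splitAt (n * 2) m v
    ... | inj₂ j | refl = cls j , refl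
    ... | inj₁ w | refl with combine-surjective {n} {2} w
    ...   | i , 0F , refl = lit (true , i) , refl
    ...   | i , 1F , refl = lit (false , i) , refl

    pt-injective : ∀ {x y} → pt x ≡ pt y → x ≡ y
    pt-injective {apex} {apex} _ = refl
    pt-injective {cls _} {cls _} eq = cong cls (↑ʳ-injective (n * 2) _ _ (sucᶠ-injective eq))
    pt-injective {lit (b , i)} {cls j} eq = contradiction (sucᶠ-injective eq) (↑ˡ≢↑ʳ _ j)
    pt-injective {cls j} {lit (b , i)} eq = contradiction (sucᶠ-injective (sym eq)) (↑ˡ≢↑ʳ _ j)
    pt-injective {lit (b , i)} {lit (b′ , i′)} eq
      with combine-injective i (side b) i′ (side b′) (↑ˡ-injective m _ _ (sucᶠ-injective eq))
    pt-injective {lit (true  , i)} {lit (true  , _)} eq | refl , _ = refl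
    pt-injective {lit (false , i)} {lit (false , _)} eq | refl , _ = refl

    ⟨_⟩ : Vertex → Subset #V
    ⟨ x ⟩ = ⁅ pt x ⁆

    ⟨_∣_⟩ : Vertex → Vertex → Subset #V
    ⟨ x ∣ y ⟩ = ⁅ pt x ⁆ ∪ ⁅ pt y ⁆

    -- Given as a bit vector in the order of `pt`, from which its row of the incidence matrix can be
    -- read off.
    apexEdge : Subset #V
    apexEdge = true ∷ (⊥ {n * 2} Vec.++ ⊤)

    x∈⟨x⟩ : ∀ x → pt x ∈ ⟨ x ⟩
    x∈⟨x⟩ x = x∈⁅x⁆ (pt x)

    ∈-⟨⟩ : ∀ {x y} → pt y ∈ ⟨ x ⟩ → y ≡ x
    ∈-⟨⟩ {x} y∈ = pt-injective (x∈⁅y⁆⇒x≡y (pt x) y∈)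

    fst∈ : ∀ x y → pt x ∈ ⟨ x ∣ y ⟩
    fst∈ x y = p⊆p∪q ⁅ pt y ⁆ (x∈⁅x⁆ (pt x))

    snd∈ : ∀ x y → pt y ∈ ⟨ x ∣ y ⟩
    snd∈ x y = q⊆p∪q ⁅ pt x ⁆ ⁅ pt y ⁆ (x∈⁅x⁆ (pt y))

    ∈-⟨∣⟩ : ∀ {x y z} → pt z ∈ ⟨ x ∣ y ⟩ → z ≡ x ⊎ z ≡ y
    ∈-⟨∣⟩ {x} {y} z∈ with x∈p∪q⁻ ⁅ pt x ⁆ ⁅ pt y ⁆ z∈
    ... | inj₁ z∈x = inj₁ (∈-⟨⟩ z∈x)
    ... | inj₂ z∈y = inj₂ (∈-⟨⟩ z∈y)

    apex∈apexEdge : pt apex ∈ apexEdge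
    apex∈apexEdge = here

    cls∈apexEdge : ∀ j → pt (cls j) ∈ apexEdge
    cls∈apexEdge j = there (lookup⇒[]= _ _
      (trans (lookup-++ʳ (⊥ {n * 2}) ⊤ j) (lookup-replicate j true)))

    ∈-apexEdge : ∀ {x} → pt x ∈ apexEdge → x ≡ apex ⊎ (∃[ j ] x ≡ cls j)
    ∈-apexEdge {apex} _ = inj₁ refl
    ∈-apexEdge {cls j} _ = inj₂ (j , refl)
    ∈-apexEdge {lit (b , i)} (there x∈)
      with () ← trans (sym ([]=⇒lookup x∈))
        (trans (lookup-++ˡ (⊥ {n * 2}) (⊤ {m}) (combine i (side b)))
          (lookup-replicate (combine i (side b)) false))

  unitEdge : Literal n → Subset #V
  unitEdge l = ⟨ lit l ⟩

  pairEdge : Fin n → Subset #V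
  pairEdge i = ⟨ lit (true , i) ∣ lit (false , i) ⟩

  linkEdge : Fin m → Literal n → Subset #V
  linkEdge j l = ⟨ lit l ∣ cls j ⟩

  varEdges : Fin n → Vec (Subset #V) 3
  varEdges i = unitEdge (true , i) ∷ unitEdge (false , i) ∷ pairEdge i ∷ []

  clauseEdges : Fin m → Vec (Subset #V) 3
  clauseEdges j = Vec.map (linkEdge j) (lookup clauses j)

  H : Hypergraph
  H = hypergraph #V (suc (n * 3 + m * 3))
        (apexEdge ∷ concat (tabulate varEdges) Vec.++ concat (tabulate clauseEdges))

  open Hypergraph H using (edges)

  -- Arguments about all edges go by cases on this view; `edge` and `index` translate between it and
  -- positions in `edges`.
  data Edge : Subset #V → Set where
    apexᵉ : Edge apexEdge
    unitᵉ : ∀ l → Edge (unitEdge l)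
    pairᵉ : ∀ i → Edge (pairEdge i)
    linkᵉ : ∀ j k → Edge (linkEdge j (lookup (lookup clauses j) k))

  edge : ∀ a → Edge (lookup edges a)
  edge = AllVₚ.lookup⁺ {P = Edge} {xs = edges} (apexᵉ ∷ AllVₚ.++⁺
    (AllVₚ.concat⁺ (AllVₚ.tabulate⁺ λ i → unitᵉ _ ∷ unitᵉ _ ∷ pairᵉ i ∷ []))
    (AllVₚ.concat⁺ (AllVₚ.tabulate⁺ λ j → AllVₚ.map⁺ (AllVₚ.lookup⁻ (linkᵉ j)))))

  index : ∀ {e} → Edge e → ∃[ a ] e ≡ lookup edges a
  index ε = AnyV.index (member ε) , AnyVₚ.lookup-index (member ε)
    where
    member : ∀ {e} → Edge e → e ∈ᵛ edges
    member apexᵉ = here refl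
    member (unitᵉ (true , i)) = there (∈-++⁺ˡ (AnyVₚ.concat⁺ (AnyVₚ.tabulate⁺ i (here refl))))
    member (unitᵉ (false , i)) =
      there (∈-++⁺ˡ (AnyVₚ.concat⁺ (AnyVₚ.tabulate⁺ i (there (here refl)))))
    member (pairᵉ i) =
      there (∈-++⁺ˡ (AnyVₚ.concat⁺ (AnyVₚ.tabulate⁺ i (there (there (here refl))))))
    member (linkᵉ j k) = there (∈-++⁺ʳ (concat (tabulate varEdges))
      (AnyVₚ.concat⁺ (AnyVₚ.tabulate⁺ j (∈-map⁺ (linkEdge j) (∈-lookup k (lookup clauses j))))))

  module Times (t : Vertex → ℕ) where

    time : Fin #V → ℕ
    time = t ∘ proj₁ ∘ name

    time-pt : ∀ x → time (pt x) ≡ t x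
    time-pt x = cong t (pt-injective (proj₂ (name (pt x))))

    tops : ∀ x {e} → pt x ∈ e → (∀ {y} → pt y ∈ e → y ≢ x → t y < t x) → Tops time (pt x) e
    tops x x∈e below = x∈e , λ {u} u∈e u≢x →
      subst (time u <_) (sym (time-pt x))
        (below (subst (_∈ _) (sym (proj₂ (name u))) u∈e)
          λ y≡x → u≢x (trans (sym (proj₂ (name u))) (cong pt y≡x)))

    pair-below : ∀ {x y} → t x < t y → (∀ {z} → pt z ∈ ⟨ x ∣ y ⟩ → z ≢ y → t z < t y)
    pair-below x<y z∈ z≢y with ∈-⟨∣⟩ z∈
    ... | inj₁ refl = x<y
    ... | inj₂ z≡y  = contradiction z≡y z≢y

    pair-above : ∀ {x y} → t y < t x → (∀ {z} → pt z ∈ ⟨ x ∣ y ⟩ → z ≢ x → t z < t x)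
    pair-above y<x z∈ z≢x with ∈-⟨∣⟩ z∈
    ... | inj₁ z≡x  = contradiction z≡x z≢x
    ... | inj₂ refl = y<x

    unit-tops : ∀ l → Tops time (pt (lit l)) (unitEdge l)
    unit-tops l = tops (lit l) (x∈⟨x⟩ (lit l)) λ y∈ y≢ → contradiction (∈-⟨⟩ y∈) y≢

    apex-tops : (∀ j → t (cls j) < t apex) → Tops time (pt apex) apexEdge
    apex-tops cls<apex = tops apex apex∈apexEdge λ y∈ y≢ →
      [ (λ y≡ → contradiction y≡ y≢) , (λ { (j , refl) → cls<apex j }) ]′ (∈-apexEdge y∈)

    -- Literals top their unit edges under any times, the apex tops `apexEdge`, and a clause vertex
    -- tops its link to an earlier literal. This serves both the core `⊥` and the layering.
    pt-topped : (∀ j → t (cls j) < t apex) →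
                (∀ j → ∃[ k ] t (lit (lookup (lookup clauses j) k)) < t (cls j)) →
                ∀ v → ∃[ a ] Tops time v (lookup edges a)
    pt-topped cls<apex lit<cls v =
      subst (λ v → ∃[ a ] Tops time v (lookup edges a)) (proj₂ (name v)) (topped (proj₁ (name v)))
      where
      at : ∀ {x e} → Edge e → Tops time (pt x) e → ∃[ a ] Tops time (pt x) (lookup edges a)
      at {x} ε top with a , eq ← index ε = a , subst (Tops time (pt x)) eq top
      topped : ∀ x → ∃[ a ] Tops time (pt x) (lookup edges a)
      topped apex = at apexᵉ (apex-tops cls<apex)
      topped (lit l) = at (unitᵉ l) (unit-tops l)
      topped (cls j) with k , lit<c ← lit<cls j =
        at (linkᵉ j k) (tops (cls j) (snd∈ _ _) (pair-below lit<c))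

  -- All literals may get time 0, whether or not the formula is satisfiable: a core only needs an
  -- edge activating each vertex, and edges that become contained are removed. Only a layering
  -- forces the two literals of a pair apart.
  ⊥-core : IsCore H ⊥
  ⊥-core = topped⇒⊥-core H time (pt-topped (λ _ → ≤-refl) (λ _ → 0F , ≤-refl))
    where
    t : Vertex → ℕ
    t apex    = 2
    t (lit _) = 0
    t (cls _) = 1
    open Times t

  ⊥-minimum : IsMinimumCore H ⊥
  ⊥-minimum = ⊥-core , λ D _ → subst (_≤ ∣ D ∣) (sym (∣⊥∣≡0 #V)) z≤n

  minimum⇒⊥ : ∀ {C} → IsMinimumCore H C → C ≡ ⊥
  minimum⇒⊥ {C} (_ , min) = ∣p∣≡0⇒p≡⊥ C (n≤0⇒n≡0 (subst (∣ C ∣ ≤_) (∣⊥∣≡0 #V) (min ⊥ ⊥-core)))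

  -- From satisfying assignments to layerings

  module Complete (α : Fin n → Bool) (sat : ∀ j → ClauseTrue α (lookup clauses j)) where

    t : Vertex → Fin 3
    t apex    = 2F
    t (cls _) = 1F
    t (lit (b , i)) with α i ≟ᵇ b
    ... | yes _ = 0F
    ... | no  _ = 2F

    true-first : ∀ {b i} → α i ≡ b → t (lit (b , i)) ≡ 0F
    true-first {b} {i} eq with α i ≟ᵇ b
    ... | yes _ = refl
    ... | no ¬eq = contradiction eq ¬eq

    false-last : ∀ {b i} → α i ≢ b → t (lit (b , i)) ≡ 2F
    false-last {b} {i} ¬eq with α i ≟ᵇ b
    ... | yes eq = contradiction eq ¬eq
    ... | no _ = refl

    open Times (toℕ ∘ t)

    0<2 : ∀ {s u : Fin 3} → s ≡ 0F → u ≡ 2F → toℕ s < toℕ u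
    0<2 refl refl = s≤s z≤n

    layering : HasLayering H ⊥ 3
    layering = topped⇒HasLayering H (t ∘ proj₁ ∘ name)
      (pt-topped (λ _ → ≤-refl) clause)
      (top ∘ edge)
      where
      clause : ∀ j → ∃[ k ] toℕ (t (lit (lookup (lookup clauses j) k))) < 1
      clause j = AnyV.index (sat j) ,
        subst (λ s → toℕ s < 1) (sym (true-first (AnyVₚ.lookup-index (sat j)))) ≤-refl
      top : ∀ {e} → Edge e → ∃[ v ] Tops time v e
      top apexᵉ = _ , apex-tops λ _ → ≤-refl
      top (unitᵉ l) = _ , unit-tops l
      top (pairᵉ i) with α i in eq
      ... | true  = _ , tops (lit (false , i)) (snd∈ _ _)
        (pair-below (0<2 (true-first eq) (false-last (not-¬ eq))))
      ... | false = _ , tops (lit (true , i)) (fst∈ _ _)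
        (pair-above (0<2 (true-first eq) (false-last (not-¬ eq))))
      -- The link to a true literal activates the clause vertex. The link to a false literal waits
      -- for the last layer, where it activates the literal.
      top (linkᵉ j k) with lookup (lookup clauses j) k
      ... | b , i with α i ≟ᵇ b
      ...   | yes eq = _ , tops (cls j) (snd∈ _ _)
        (pair-below (subst (λ s → toℕ s < 1) (sym (true-first eq)) ≤-refl))
      ...   | no ¬eq = _ , tops (lit (b , i)) (fst∈ _ _)
        (pair-above (subst (λ s → 1 < toℕ s) (sym (false-last ¬eq)) ≤-refl))

  -- From layerings to satisfying assignments

  module Sound {r : ℕ} (r≤3 : r ≤ 3) (layer : Vec (Fin r) (Hypergraph.#edges H))
               (layering : IsLayering H ⊥ layer) where

    W : ℕ → Subset #V
    W = V H ⊥ layer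

    private
      ℓ : Fin (Hypergraph.#edges H) → ℕ
      ℓ a = toℕ (lookup layer a)

      missing : ∀ a {i} → ℓ a ≡ i → OneMissing (lookup edges a) (W i)
      missing a refl = layering a

    W-unique : ∀ {e i x y} → OneMissing e (W i) → pt x ∈ e → pt y ∈ e → x ≢ y →
               pt x ∉ W i → pt y ∈ W i
    W-unique missing x∈e y∈e x≢y = oneMissing-unique missing x∈e y∈e (x≢y ∘ pt-injective)

    -- Every edge through a clause vertex has a second vertex, so two vertices are missing as long
    -- as nothing is active.
    cls∉W₁ : ∀ j → pt (cls j) ∉ W 1
    cls∉W₁ j c∈W with ∈-V-suc⁻ H ⊥ layer 0 c∈W
    ... | inj₁ c∈⊥ = ∉⊥ c∈⊥
    ... | inj₂ (a , ℓ≡0 , c∈e) = absurd (edge a) c∈e (missing a ℓ≡0)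
      where
      absurd : ∀ {e} → Edge e → pt (cls j) ∈ e → ¬ OneMissing e (W 0)
      absurd apexᵉ c∈e miss = ∉⊥ (W-unique {i = 0} miss c∈e apex∈apexEdge (λ ()) ∉⊥)
      absurd (unitᵉ l) c∈e miss with () ← ∈-⟨⟩ c∈e
      absurd (pairᵉ i) c∈e miss with ∈-⟨∣⟩ c∈e
      ... | inj₁ ()
      ... | inj₂ ()
      absurd (linkᵉ _ _) c∈e miss = ∉⊥ (W-unique {i = 0} miss c∈e (fst∈ _ _) (λ ()) ∉⊥)

    private
      -- The layer of `apexEdge`, which stands first in `edges`.
      s : ℕ
      s = ℓ zero

      apexEdge⊈Wₛ : ¬ (apexEdge ⊆ W s)
      apexEdge⊈Wₛ e⊆W
        with v , v∈e , v∉W , _ ← oneMissing⁻ apexEdge (W s) (layering zero) = v∉W (e⊆W v∈e)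

      apex∈⇒apexEdge : ∀ {e} → Edge e → pt apex ∈ e → e ≡ apexEdge
      apex∈⇒apexEdge apexᵉ _ = refl
      apex∈⇒apexEdge (unitᵉ l) apex∈ with () ← ∈-⟨⟩ apex∈
      apex∈⇒apexEdge (pairᵉ i) apex∈ with ∈-⟨∣⟩ apex∈
      ... | inj₁ ()
      ... | inj₂ ()
      apex∈⇒apexEdge (linkᵉ j k) apex∈ with ∈-⟨∣⟩ apex∈
      ... | inj₁ ()
      ... | inj₂ ()

      -- An edge through the apex equals `apexEdge` as a set. In a layer before `s` it would make
      -- `apexEdge` a subset of `W s`, where one of its vertices is still missing.
      apex∉ : ∀ i → i ≤ s → pt apex ∉ W i
      apex∉ zero _ apex∈ = ∉⊥ apex∈
      apex∉ (suc i) i<s apex∈ with ∈-V-suc⁻ H ⊥ layer i apex∈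
      ... | inj₁ apex∈W = apex∉ i (<⇒≤ i<s) apex∈W
      ... | inj₂ (a , refl , apex∈e) = apexEdge⊈Wₛ λ x∈ →
        V-mono H ⊥ layer i<s (∈-layer⇒∈-V H ⊥ layer a
          (subst (_ ∈_) (sym (apex∈⇒apexEdge (edge a) apex∈e)) x∈))

      -- The apex is the missing vertex of `apexEdge` at `W s`, so the clause vertices are not.
      cls∈Wₛ : ∀ j → pt (cls j) ∈ W s
      cls∈Wₛ j =
        W-unique {i = s} (layering zero) apex∈apexEdge (cls∈apexEdge j) (λ ()) (apex∉ s ≤-refl)

      -- Layers are numbered from 0, so the last of three has number 2, and `W 2` is what two layers
      -- activate.
      s≤2 : s ≤ 2
      s≤2 = s≤s⁻¹ (<-≤-trans (toℕ<n (lookup layer zero)) r≤3)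

      -- The clause `j` matters: without clauses, `apexEdge` has the apex alone and may lie in layer
      -- 0.
      1<s : Fin m → 1 < s
      1<s j = ≰⇒> λ s≤1 → cls∉W₁ j (V-mono H ⊥ layer s≤1 (cls∈Wₛ j))

    -- The clause vertex is activated in layer 1. The edge doing this is not `apexEdge`, of which
    -- the apex is missing as well, so it is a link, and its literal must be active before.
    literal∈W₁ : ∀ j → ∃[ k ] pt (lit (lookup (lookup clauses j) k)) ∈ W 1
    literal∈W₁ j with ∈-V-suc⁻ H ⊥ layer 1 (V-mono H ⊥ layer s≤2 (cls∈Wₛ j))
    ... | inj₁ c∈W₁ = contradiction c∈W₁ (cls∉W₁ j)
    ... | inj₂ (a , ℓ≡1 , c∈e) = from (edge a) c∈e (missing a ℓ≡1)
      where
      from : ∀ {e} → Edge e → pt (cls j) ∈ e → OneMissing e (W 1) →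
             ∃[ k ] pt (lit (lookup (lookup clauses j) k)) ∈ W 1
      from apexᵉ c∈e miss = contradiction
        (W-unique {i = 1} miss c∈e apex∈apexEdge (λ ()) (cls∉W₁ j))
        (apex∉ 1 (<⇒≤ (1<s j)))
      from (unitᵉ l) c∈e _ with () ← ∈-⟨⟩ c∈e
      from (pairᵉ i) c∈e _ with ∈-⟨∣⟩ c∈e
      ... | inj₁ ()
      ... | inj₂ ()
      from (linkᵉ j k) c∈e miss with ∈-⟨∣⟩ c∈e
      ... | inj₂ refl = k , W-unique {i = 1} miss c∈e (fst∈ _ _) (λ ()) (cls∉W₁ j)

    -- The pair edge must lie in some layer. In layer 0 both its vertices would be missing, in a
    -- later one neither, as both would be active from `W 1` on.
    consistent : ∀ i → pt (lit (true , i)) ∈ W 1 → pt (lit (false , i)) ∉ W 1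
    consistent i x∈ x̄∈ with a , eq ← index (pairᵉ i) =
      clash (ℓ a) (subst (λ e → OneMissing e (W (ℓ a))) (sym eq) (layering a))
      where
      clash : ∀ k → ¬ OneMissing (pairEdge i) (W k)
      clash zero miss = ∉⊥ (W-unique {i = 0} miss (fst∈ _ _) (snd∈ _ _) (λ ()) ∉⊥)
      clash (suc k) miss with v , v∈ , v∉ , _ ← oneMissing⁻ (pairEdge i) (W (suc k)) miss
        with name v
      ... | x , refl with ∈-⟨∣⟩ v∈
      ...   | inj₁ refl = v∉ (V-mono H ⊥ layer (s≤s z≤n) x∈)
      ...   | inj₂ refl = v∉ (V-mono H ⊥ layer (s≤s z≤n) x̄∈)

    -- A variable with neither literal in `W 1` gets the default `false`; this is harmless, since
    -- only literals in `W 1` have to come out true.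
    α : Fin n → Bool
    α i = lookup (W 1) (pt (lit (true , i)))

    literal-true : ∀ l → pt (lit l) ∈ W 1 → LiteralTrue α l
    literal-true (true , i) x∈ = []=⇒lookup x∈
    literal-true (false , i) x̄∈ = ¬-not λ αi → consistent i (lookup⇒[]= _ _ αi) x̄∈

    satisfiable : Satisfiable φ
    satisfiable = α , λ j → let k , l∈ = literal∈W₁ j in
      AnyV.map (λ { refl → literal-true _ l∈ }) (∈-lookup k (lookup clauses j))

  image : MinCoreInstance
  image = minCoreInstance H 3

  correct : Satisfiable φ ⇔ HasMinimumCoreOfRadius≤ image
  correct = mk⇔
    (λ (α , sat) → ⊥ , ⊥-minimum , HasLayering⇒IsRadius H ⊥ 3 (Complete.layering α sat))
    (λ (C , minimum , r , ((layer , layering) , _) , r≤3) → Sound.satisfiable r≤3 layer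
      (subst (λ C → IsLayering H C layer) (minimum⇒⊥ minimum) layering))

-- Running times

-- With base at least 2, powers grow with the exponent and a sum of two bounds is absorbed by one
-- more factor, so no coefficients are needed.
PolyBounded : (ℕ → ℕ) → Set
PolyBounded f = ∃[ d ] ∀ B → f B ≤ (2 + B) ^ d

poly-1 : PolyBounded λ _ → 1
poly-1 = 0 , λ _ → ≤-refl

poly-id : PolyBounded id
poly-id = 1 , λ B → ≤-trans (m≤n+m B 2) (≤-reflexive (sym (*-identityʳ (2 + B))))

module _ {f g : ℕ → ℕ} where
  open ≤-Reasoning

  poly-+ : PolyBounded f → PolyBounded g → PolyBounded λ B → f B + g B
  poly-+ (a , f≤) (b , g≤) = suc (a + b) , λ B → begin
    f B + g B                          ≤⟨ +-mono-≤ (f≤ B) (g≤ B) ⟩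
    (2 + B) ^ a + (2 + B) ^ b          ≤⟨ +-mono-≤ (^-monoʳ-≤ (2 + B) (m≤m+n a b))
                                                   (^-monoʳ-≤ (2 + B) (m≤n+m b a)) ⟩
    (2 + B) ^ (a + b) + (2 + B) ^ (a + b)
      ≤⟨ +-monoʳ-≤ ((2 + B) ^ (a + b)) (m≤m+n ((2 + B) ^ (a + b)) (B * (2 + B) ^ (a + b))) ⟩
    (2 + B) * (2 + B) ^ (a + b)        ∎

  poly-* : PolyBounded f → PolyBounded g → PolyBounded λ B → f B * g B
  poly-* (a , f≤) (b , g≤) = a + b , λ B → begin
    f B * g B                  ≤⟨ *-mono-≤ (f≤ B) (g≤ B) ⟩
    (2 + B) ^ a * (2 + B) ^ b  ≡⟨ ^-distribˡ-+-* (2 + B) a b ⟨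
    (2 + B) ^ (a + b)          ∎

poly-const : ∀ k → PolyBounded λ _ → k
poly-const zero    = 0 , λ _ → z≤n
poly-const (suc k) = poly-+ poly-1 (poly-const k)

-- Brings bounds into the form `c * n ^ d + c` of `PolyTime`. For positive `n` the first summand
-- suffices, as `2 + n ≤ 3 * n`; the second covers `n = 0`.
[2+n]^d≤ : ∀ n d → (2 + n) ^ d ≤ 3 ^ d * n ^ d + 3 ^ d
[2+n]^d≤ zero d = ≤-trans (^-monoˡ-≤ d (n≤1+n 2)) (m≤n+m (3 ^ d) (3 ^ d * 0 ^ d))
[2+n]^d≤ n@(suc k) d = begin
  (2 + n) ^ d            ≤⟨ ^-monoˡ-≤ d 2+n≤3n ⟩
  (3 * n) ^ d            ≡⟨ ^-distribʳ-* d 3 n ⟩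
  3 ^ d * n ^ d          ≤⟨ m≤m+n _ _ ⟩
  3 ^ d * n ^ d + 3 ^ d  ∎
  where
  open ≤-Reasoning
  ^-distribʳ-* : ∀ d m n → (m * n) ^ d ≡ m ^ d * n ^ d
  ^-distribʳ-* zero m n = refl
  ^-distribʳ-* (suc d) m n = trans (cong (m * n *_) (^-distribʳ-* d m n))
    ([m*n]*[o*p]≡[m*o]*[n*p] m n (m ^ d) (n ^ d))
  2+n≤3n : 2 + n ≤ 3 * n
  2+n≤3n = begin
    2 + n            ≡⟨ +-comm 2 n ⟩
    n + 2            ≤⟨ +-monoʳ-≤ n (*-monoʳ-≤ 2 {1} {n} (s≤s z≤n)) ⟩
    n + 2 * n        ∎

-- Bounds the running time if no loop is repeated more than B times.
cost : ∀ {s} → Program s → ℕ → ℕ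
cost (push _ _)     B = 1
cost (pop _)        B = 1
cost (p ⨾ q)        B = cost p B + cost q B
cost (ifᵗ _ _ p q)  B = 1 + (cost p B + cost q B)
cost (whileᵗ _ _ p) B = 1 + B * (1 + cost p B)

cost-poly : ∀ {s} (p : Program s) → PolyBounded (cost p)
cost-poly (push _ _)     = poly-1
cost-poly (pop _)        = poly-1
cost-poly (p ⨾ q)        = poly-+ (cost-poly p) (cost-poly q)
cost-poly (ifᵗ _ _ p q)  = poly-+ poly-1 (poly-+ (cost-poly p) (cost-poly q))
cost-poly (whileᵗ _ _ p) = poly-+ poly-1 (poly-* poly-id (poly-+ poly-1 (cost-poly p)))

length-updateAt-≤ : ∀ {s} (σ : Store s) i j f → (∀ x → length (f x) ≤ suc (length x)) →
                    length (lookup (σ [ i ]%= f) j) ≤ suc (length (lookup σ j))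
length-updateAt-≤ σ i j f f≤ with j ≟ᶠ i
... | yes refl rewrite lookup∘updateAt i {f} σ = f≤ (lookup σ i)
... | no j≢i rewrite lookup∘updateAt′ j i {f} j≢i σ = n≤1+n _

≤-+-trans : ∀ {k l m} t u → l ≤ t + k → m ≤ u + l → m ≤ t + u + k
≤-+-trans {k} {l} {m} t u l≤ m≤ = begin
  m            ≤⟨ m≤ ⟩
  u + l        ≤⟨ +-monoʳ-≤ u l≤ ⟩
  u + (t + k)  ≡⟨ +-assoc u t k ⟨
  u + t + k    ≡⟨ cong (_+ k) (+-comm u t) ⟩
  t + u + k    ∎
  where open ≤-Reasoning

-- A step lengthens a stack by at most one bit. This bounds the printed output, hence the number of
-- iterations of `reverseOut`.
length-⇓-≤ : ∀ {s} {p : Program s} {σ τ t} → ⟨ p , σ ⟩⇓[ t ] τ → ∀ j →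
             length (lookup τ j) ≤ t + length (lookup σ j)
length-⇓-≤ (push⇓ {σ} {i} {b}) j = length-updateAt-≤ σ i j (b ∷_) λ _ → ≤-refl
length-⇓-≤ (pop⇓ {σ} {i}) j = length-updateAt-≤ σ i j (drop 1) λ x →
  ≤-trans (≤-reflexive (length-drop 1 x)) (≤-trans (m∸n≤m (length x) 1) (n≤1+n _))
length-⇓-≤ (seq⇓ {t = t} {u} p⇓ q⇓) j = ≤-+-trans t u (length-⇓-≤ p⇓ j) (length-⇓-≤ q⇓ j)
length-⇓-≤ (then⇓ _ p⇓) j = m≤n⇒m≤1+n (length-⇓-≤ p⇓ j)
length-⇓-≤ (else⇓ _ p⇓) j = m≤n⇒m≤1+n (length-⇓-≤ p⇓ j)
length-⇓-≤ (exit⇓ _) j = n≤1+n _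
length-⇓-≤ (repeat⇓ {t = t} {u} _ p⇓ q⇓) j =
  m≤n⇒m≤1+n (≤-+-trans t u (length-⇓-≤ p⇓ j) (length-⇓-≤ q⇓ j))

-- Printing with stacks

ones : ℕ → List Bool
ones n = List.replicate n true

infixr 8 _×̇_
_×̇_ : ℕ → List Bool → List Bool
k ×̇ w = List.concat (List.replicate k w)

isTrue : Test
isTrue (just b) = b
isTrue nothing  = false

isBit : Test
isBit (just _) = true
isBit nothing  = false

-- The argument is the content of the stack out: the output so far, last bit first.
State : Set
State = List Bool → Store 7

module Run (B : ℕ) where

  -- A Hoare triple with a time bound. It holds for every earlier output `o`, so that triples
  -- compose by concatenating what is printed.
  record Prints (p : Program 7) (A A′ : State) (w : List Bool) : Set where
    constructor prints
    field runs : ∀ o → ∃[ t ] t ≤ cost p B × ⟨ p , A o ⟩⇓[ t ] A′ (w ʳ++ o)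

  -- Counts the remaining iterations exactly, as induction requires; `looped` then relaxes `k` to
  -- `B`.
  record Loops (k : ℕ) (i : Fin 7) (φ : Test) (p : Program 7)
               (A A′ : State) (w : List Bool) : Set where
    constructor loops
    field runs : ∀ o → ∃[ t ] t ≤ 1 + k * (1 + cost p B)
                            × ⟨ whileᵗ i φ p , A o ⟩⇓[ t ] A′ (w ʳ++ o)

  pushed : ∀ {i b A A′} → (∀ o → A o [ i ]%= (b ∷_) ≡ A′ o) → Prints (push i b) A A′ []
  pushed {i} {b} {A} eq = prints λ o →
    1 , ≤-refl , subst (⟨ push i b , A o ⟩⇓[ 1 ]_) (eq o) push⇓

  popped : ∀ {i A A′} → (∀ o → A o [ i ]%= drop 1 ≡ A′ o) → Prints (pop i) A A′ []
  popped {i} {A} eq = prints λ o →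
    1 , ≤-refl , subst (⟨ pop i , A o ⟩⇓[ 1 ]_) (eq o) pop⇓

  printed : ∀ {i b A A′} → (∀ o → A o [ i ]%= (b ∷_) ≡ A′ (b ∷ o)) → Prints (push i b) A A′ [ b ]
  printed {i} {b} {A} eq = prints λ o →
    1 , ≤-refl , subst (⟨ push i b , A o ⟩⇓[ 1 ]_) (eq o) push⇓

  infixr 5 _⊳_
  _⊳_ : ∀ {p q A₁ A₂ A₃ v w} → Prints p A₁ A₂ v → Prints q A₂ A₃ w → Prints (p ⨾ q) A₁ A₃ (v ++ w)
  _⊳_ {p} {q} {A₁} {A₂} {A₃} {v} (prints P) (prints Q) = prints λ o →
    let t , t≤ , p⇓ = P o ; u , u≤ , q⇓ = Q (v ʳ++ o)
    in t + u , +-mono-≤ t≤ u≤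
     , subst (λ x → ⟨ p ⨾ q , A₁ o ⟩⇓[ t + u ] A₃ x) (sym (++-ʳ++ v)) (seq⇓ p⇓ q⇓)

  branch-true : ∀ {i φ p q A A′ w} → (∀ o → test (A o) i φ ≡ true) →
                Prints p A A′ w → Prints (ifᵗ i φ p q) A A′ w
  branch-true holds (prints P) = prints λ o →
    let t , t≤ , p⇓ = P o
    in suc t , s≤s (≤-trans t≤ (m≤m+n _ _)) , then⇓ (holds o) p⇓

  branch-false : ∀ {i φ p q A A′ w} → (∀ o → test (A o) i φ ≡ false) →
                 Prints q A A′ w → Prints (ifᵗ i φ p q) A A′ w
  branch-false fails (prints Q) = prints λ o →
    let t , t≤ , q⇓ = Q o
    in suc t , s≤s (≤-trans t≤ (m≤n+m _ _)) , else⇓ (fails o) q⇓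

  stop : ∀ {i φ p A} → (∀ o → test (A o) i φ ≡ false) → Loops 0 i φ p A A []
  stop fails = loops λ o → 1 , ≤-refl , exit⇓ (fails o)

  again : ∀ {k i φ p A₁ A₂ A₃ v w} → (∀ o → test (A₁ o) i φ ≡ true) →
          Prints p A₁ A₂ v → Loops k i φ p A₂ A₃ w → Loops (suc k) i φ p A₁ A₃ (v ++ w)
  again {k} {i} {φ} {p} {A₁} {A₂} {A₃} {v} holds (prints P) (loops Q) = loops λ o →
    let t , t≤ , p⇓ = P o ; u , u≤ , q⇓ = Q (v ʳ++ o)
    in suc (t + u)
     , s≤s (≤-trans (+-mono-≤ t≤ u≤) (≤-reflexive (+-suc (cost p B) _)))
     , subst (λ x → ⟨ whileᵗ i φ p , A₁ o ⟩⇓[ suc (t + u) ] A₃ x) (sym (++-ʳ++ v))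
         (repeat⇓ (holds o) p⇓ q⇓)

  looped : ∀ {k i φ p A A′ w} → k ≤ B → Loops k i φ p A A′ w → Prints (whileᵗ i φ p) A A′ w
  looped {p = p} k≤B (loops P) = prints λ o →
    let t , t≤ , p⇓ = P o
    in t , ≤-trans t≤ (s≤s (*-monoˡ-≤ (1 + cost p B) k≤B)) , p⇓

pattern inp = 0F
pattern out = 1F
pattern tmp = 6F

-- When a row is printed, the counters hold the numbers of variables and of clauses that come
-- before and after the current one.
data Counter : Set where
  xsBefore xsAfter csBefore csAfter : Counter

cell : Counter → Fin 7
cell xsBefore = 2F
cell xsAfter  = 3F
cell csBefore = 4F
cell csAfter  = 5F

st : List Bool → ℕ → ℕ → ℕ → ℕ → State
st x i r j k o = x ∷ o ∷ ones i ∷ ones r ∷ ones j ∷ ones k ∷ [] ∷ []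

move : Fin 7 → Fin 7 → Program 7
move c d = whileᵗ c isTrue (pop c ⨾ push d true)

-- Programs cannot be empty, so emit [] pushes a bit and takes it back.
emit : List Bool → Program 7
emit []      = push out true ⨾ pop out
emit (b ∷ w) = push out b ⨾ emit w

-- Reading a counter consumes it, so its bits are kept on `tmp` and moved back for later use.
repeat : Fin 7 → List Bool → Program 7
repeat c w = whileᵗ c isTrue (pop c ⨾ push tmp true ⨾ emit w) ⨾ move tmp c

infixr 6 _∙_

-- A small language of rows with a value, `text`, and a program, `print`, so that printing is
-- verified once for all rows.
data Text : Set where
  word : List Bool → Text
  rep  : Counter → List Bool → Text
  _∙_  : Text → Text → Text

text : Text → ℕ → ℕ → ℕ → ℕ → List Bool
text (word w)         i r j k = w
text (rep xsBefore w) i r j k = i ×̇ w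
text (rep xsAfter w)  i r j k = r ×̇ w
text (rep csBefore w) i r j k = j ×̇ w
text (rep csAfter w)  i r j k = k ×̇ w
text (T ∙ U)          i r j k = text T i r j k ++ text U i r j k

print : Text → Program 7
print (word w)  = emit w
print (rep c w) = repeat (cell c) w
print (T ∙ U)   = print T ⨾ print U

-- Says that `c`, `tmp` and `out` are separate stacks of `σ` holding its arguments; thus
-- `repeat-prints` treats all four counters at once.
record Cells (c : Fin 7) (σ : (x y o : List Bool) → Store 7) : Set where
  constructor cells
  field
    read-c  : ∀ {x y o} → lookup (σ x y o) c ≡ x
    read-t  : ∀ {x y o} → lookup (σ x y o) tmp ≡ y
    write-c : ∀ f {x y o} → σ x y o [ c ]%= f ≡ σ (f x) y o
    write-t : ∀ f {x y o} → σ x y o [ tmp ]%= f ≡ σ x (f y) o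
    write-o : ∀ f {x y o} → σ x y o [ out ]%= f ≡ σ x y (f o)

module _ {B : ℕ} where
  open Run B

  emit-prints : ∀ {A} → (∀ f o → A o [ out ]%= f ≡ A (f o)) → ∀ w → Prints (emit w) A A w
  emit-prints {A} write-o [] =
    pushed {A′ = A ∘ (true ∷_)} (write-o (true ∷_)) ⊳ popped (λ o → write-o (drop 1) (true ∷ o))
  emit-prints write-o (b ∷ w) = printed (write-o (b ∷_)) ⊳ emit-prints write-o w

  repeat-prints : ∀ {c σ} → Cells c σ → ∀ {k} → k ≤ B → ∀ w →
                  Prints (repeat c w) (σ (ones k) []) (σ (ones k) []) (k ×̇ w)
  repeat-prints {c} {σ} cs {k} k≤B w =
    subst (Prints _ _ _) (++-identityʳ (k ×̇ w))
      (looped k≤B (empty k 0) ⊳ looped k≤B (refill k 0))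
    where
    open Cells cs
    empty : ∀ k l → Loops k c isTrue (pop c ⨾ push tmp true ⨾ emit w)
                      (σ (ones k) (ones l)) (σ [] (ones (l + k))) (k ×̇ w)
    empty zero l rewrite +-identityʳ l = stop λ o → cong (isTrue ∘ List.head) read-c
    empty (suc k) l rewrite +-suc l k =
      again (λ o → cong (isTrue ∘ List.head) read-c)
        (popped (λ _ → write-c (drop 1)) ⊳ pushed (λ _ → write-t (true ∷_))
          ⊳ emit-prints (λ f _ → write-o f) w)
        (empty k (suc l))
    refill : ∀ k l → Loops k tmp isTrue (pop tmp ⨾ push c true)
                       (σ (ones l) (ones k)) (σ (ones (l + k)) []) []
    refill zero l rewrite +-identityʳ l = stop λ o → cong (isTrue ∘ List.head) read-t
    refill (suc k) l rewrite +-suc l k =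
      again (λ o → cong (isTrue ∘ List.head) read-t)
        (popped (λ _ → write-t (drop 1)) ⊳ pushed (λ _ → write-c (true ∷_)))
        (refill k (suc l))

  print-prints : ∀ T {x i r j k} → i ≤ B → r ≤ B → j ≤ B → k ≤ B →
                 Prints (print T) (st x i r j k) (st x i r j k) (text T i r j k)
  print-prints (word w) _ _ _ _ = emit-prints (λ _ _ → refl) w
  print-prints (rep xsBefore w) {x} {i} {r} {j} {k} i≤ _ _ _ =
    repeat-prints {σ = λ c y o → x ∷ o ∷ c ∷ ones r ∷ ones j ∷ ones k ∷ y ∷ []}
      (cells refl refl (λ _ → refl) (λ _ → refl) (λ _ → refl)) i≤ w
  print-prints (rep xsAfter w) {x} {i} {r} {j} {k} _ r≤ _ _ =
    repeat-prints {σ = λ c y o → x ∷ o ∷ ones i ∷ c ∷ ones j ∷ ones k ∷ y ∷ []}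
      (cells refl refl (λ _ → refl) (λ _ → refl) (λ _ → refl)) r≤ w
  print-prints (rep csBefore w) {x} {i} {r} {j} {k} _ _ j≤ _ =
    repeat-prints {σ = λ c y o → x ∷ o ∷ ones i ∷ ones r ∷ c ∷ ones k ∷ y ∷ []}
      (cells refl refl (λ _ → refl) (λ _ → refl) (λ _ → refl)) j≤ w
  print-prints (rep csAfter w) {x} {i} {r} {j} {k} _ _ _ k≤ =
    repeat-prints {σ = λ c y o → x ∷ o ∷ ones i ∷ ones r ∷ ones j ∷ c ∷ y ∷ []}
      (cells refl refl (λ _ → refl) (λ _ → refl) (λ _ → refl)) k≤ w
  print-prints (T ∙ U) i≤ r≤ j≤ k≤ = print-prints T i≤ r≤ j≤ k≤ ⊳ print-prints U i≤ r≤ j≤ k≤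

-- The translating program

open Code

-- The arguments of g are an index and the numbers of smaller and of greater indices.
rows : ∀ k → (Fin k → ℕ → ℕ → List Bool) → ℕ → List Bool
rows zero    g j = []
rows (suc k) g j = g zero j k ++ rows k (g ∘ suc) (suc j)

-- The arguments 2 and 1 give the number of vertices, 3 and 3 that of edges; the leading `true`
-- counts the apex or `apexEdge`.
sizeText : ℕ → ℕ → Text
sizeText a b = word [ true ] ∙ rep xsAfter (ones a) ∙ rep csAfter (ones b) ∙ word [ false ]

00s : List Bool
00s = false ∷ false ∷ []

apexText : Text
apexText = word [ true ] ∙ rep xsAfter 00s ∙ rep csAfter [ true ]

-- The leading `false` is the entry of the apex, `p` and `q` are those of the two literals. While
-- these rows are printed, all clauses are still counted by `csAfter`.
varText : Bool → Bool → Text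
varText p q = word [ false ] ∙ rep xsBefore 00s ∙ word (p ∷ q ∷ [])
  ∙ rep xsAfter 00s ∙ rep csAfter [ false ]

linkText : Bool → Text
linkText b = word [ false ] ∙ rep xsBefore 00s ∙ word (b ∷ not b ∷ []) ∙ rep xsAfter 00s
  ∙ rep csBefore [ false ] ∙ word [ true ] ∙ rep csAfter [ false ]

varRows : ℕ → ℕ → ℕ → List Bool
varRows m i r = text (varText true false) i r 0 m ++ text (varText false true) i r 0 m
  ++ text (varText true true) i r 0 m ++ []

literalRow : ∀ {n} → Literal n → ℕ → ℕ → List Bool
literalRow {n} (b , i) = text (linkText b) (toℕ i) (n ∸ suc (toℕ i))

clauseRows : ∀ {n} → Clause n → ℕ → ℕ → List Bool
clauseRows (l₁ ∷ l₂ ∷ l₃ ∷ []) j k =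
  literalRow l₁ j k ++ literalRow l₂ j k ++ literalRow l₃ j k ++ []

-- The last bits are those of binary 3.
output : Formula → List Bool
output (formula n m cs) =
  text (sizeText 2 1) 0 n 0 m ++ text (sizeText 3 3) 0 n 0 m ++ text apexText 0 n 0 m
  ++ rows n (λ _ → varRows m) 0 ++ rows m (clauseRows ∘ lookup cs) 0 ++ 00s

-- Reading the unary name of a variable transfers the smaller variables from `xsAfter` to
-- `xsBefore`.
skipTrues : Program 7
skipTrues = whileᵗ inp isTrue (pop inp ⨾ pop (cell xsAfter) ⨾ push (cell xsBefore) true)

-- The pops of `inp` remove the sign and the `false` ending the name; the pop of `xsAfter` discounts
-- the variable itself. After printing, the counters are restored.
printLiteral : Bool → Program 7
printLiteral b = pop inp ⨾ skipTrues ⨾ pop inp ⨾ pop (cell xsAfter) ⨾ print (linkText b)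
  ⨾ push (cell xsAfter) true ⨾ move (cell xsBefore) (cell xsAfter)

readLiteral : Program 7
readLiteral = ifᵗ inp isTrue (printLiteral true) (printLiteral false)

printVar : Program 7
printVar = pop (cell xsAfter) ⨾ print (varText true false) ⨾ print (varText false true)
  ⨾ print (varText true true) ⨾ push (cell xsBefore) true

readClause : Program 7
readClause = pop (cell csAfter) ⨾ readLiteral ⨾ readLiteral ⨾ readLiteral
  ⨾ push (cell csBefore) true

translate : Program 7
translate = move inp (cell xsAfter) ⨾ pop inp ⨾ move inp (cell csAfter) ⨾ pop inp
  ⨾ print (sizeText 2 1) ⨾ print (sizeText 3 3) ⨾ print apexText
  -- The loop leaves the number of variables in `xsBefore`; it is moved back for the rows of the
  -- clauses.
  ⨾ whileᵗ (cell xsAfter) isTrue printVar ⨾ move (cell xsBefore) (cell xsAfter)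
  ⨾ whileᵗ (cell csAfter) isTrue readClause ⨾ print (word 00s)

reverseOut : Program 7
reverseOut = whileᵗ out isBit
  (ifᵗ out isTrue (pop out ⨾ push inp true) (pop out ⨾ push inp false))

module _ {B : ℕ} where
  open Run B

  -- For silent loops that consume one counter or unary number while another grows: `A k j` is the
  -- state with `k` iterations to go and `j` done.
  countdown : ∀ {i φ p} (A : ℕ → ℕ → State) →
              (∀ k j o → test (A (suc k) j o) i φ ≡ true) →
              (∀ j o → test (A 0 j o) i φ ≡ false) →
              (∀ k j → Prints p (A (suc k) j) (A k (suc j)) []) →
              ∀ k j → Loops k i φ p (A k j) (A 0 (j + k)) []
  countdown A more done step zero j rewrite +-identityʳ j = stop (done j)
  countdown A more done step (suc k) j rewrite +-suc j k =
    again (more k j) (step k j) (countdown A more done step k (suc j))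

  restore : ∀ {x r j k} i → i ≤ B →
            Prints (move (cell xsBefore) (cell xsAfter)) (st x i r j k) (st x 0 (r + i) j k) []
  restore {x} {r} {j} {k} i i≤B = looped i≤B
    (countdown (λ i r → st x i r j k) (λ _ _ _ → refl) (λ _ _ → refl)
      (λ _ _ → popped (λ _ → refl) ⊳ pushed (λ _ → refl)) i r)

  -- The number of variables appears as `i + suc r`, on which `i` pops compute, and as `suc r + i`,
  -- which `restore` yields.
  printLiteral-prints : ∀ b i r x {j k} → i ≤ B → r ≤ B → j ≤ B → k ≤ B →
    Prints (printLiteral b) (st (b ∷ unary i ++ x) 0 (i + suc r) j k) (st x 0 (suc r + i) j k)
      (text (linkText b) i r j k)
  printLiteral-prints b i r x {j} {k} i≤ r≤ j≤ k≤ =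
    subst (Prints _ _ _) (++-identityʳ (text (linkText b) i r j k))
      (popped {A′ = st (unary i ++ x) 0 (i + suc r) j k} (λ _ → refl)
      ⊳ looped i≤ (countdown (λ i l → st (unary i ++ x) l (i + suc r) j k)
          (λ _ _ _ → refl) (λ _ _ → refl)
          (λ i l → popped {A′ = st (unary i ++ x) l (suc i + suc r) j k} (λ _ → refl)
            ⊳ popped {A′ = st (unary i ++ x) l (i + suc r) j k} (λ _ → refl)
            ⊳ pushed (λ _ → refl)) i 0)
      ⊳ popped {A′ = st x i (suc r) j k} (λ _ → refl)
      ⊳ popped {A′ = st x i r j k} (λ _ → refl)
      ⊳ print-prints (linkText b) i≤ r≤ j≤ k≤
      ⊳ pushed {A′ = st x i (suc r) j k} (λ _ → refl)
      ⊳ restore i i≤)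

  readLiteral-prints : ∀ {n} (l : Literal n) x {j k} → n ≤ B → j ≤ B → k ≤ B →
    Prints readLiteral (st (enc literalCode l ++ x) 0 n j k) (st x 0 n j k) (literalRow l j k)
  readLiteral-prints {n} (b , i) x {j} {k} n≤ j≤ k≤ = choose b
    where
    r = n ∸ suc (toℕ i)
    n≡ : suc r + toℕ i ≡ n
    n≡ = trans (sym (+-suc r (toℕ i))) (m∸n+n≡m (toℕ<n i))
    row : ∀ b → Prints (printLiteral b) (st (b ∷ unary (toℕ i) ++ x) 0 n j k) (st x 0 n j k)
                  (literalRow (b , i) j k)
    row b = subst₂ (λ n₁ n₂ → Prints (printLiteral b) (st (b ∷ unary (toℕ i) ++ x) 0 n₁ j k)
                              (st x 0 n₂ j k) (literalRow (b , i) j k))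
      (trans (+-comm (toℕ i) (suc r)) n≡) n≡
      (printLiteral-prints b (toℕ i) r x (≤-trans (<⇒≤ (toℕ<n i)) n≤)
        (≤-trans (m∸n≤m n (suc (toℕ i))) n≤) j≤ k≤)
    choose : ∀ b → Prints readLiteral (st (b ∷ unary (toℕ i) ++ x) 0 n j k) (st x 0 n j k)
                     (literalRow (b , i) j k)
    choose true  = branch-true (λ _ → refl) (row true)
    choose false = branch-false (λ _ → refl) (row false)

  readClauses : ∀ {n} k (cs : Vec (Clause n) k) j → n ≤ B → j + k ≤ B →
    Loops k (cell csAfter) isTrue readClause (st (enc (vecCode clauseCode) cs) 0 n j k)
      (st [] 0 n (j + k) 0) (rows k (clauseRows ∘ lookup cs) j)
  readClauses zero [] j n≤ _ rewrite +-identityʳ j = stop λ _ → refl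
  readClauses {n} (suc k) ((l₁ ∷ l₂ ∷ l₃ ∷ []) ∷ cs) j n≤ j+k≤ rewrite +-suc j k =
    again (λ _ → refl)
      (popped {A′ = st (e₁ ++ e₂ ++ e₃ ++ x) 0 n j k} (λ o → cong (λ x → st x 0 n j k o) split)
      ⊳ readLiteral-prints l₁ (e₂ ++ e₃ ++ x) n≤ j≤ k≤
      ⊳ readLiteral-prints l₂ (e₃ ++ x) n≤ j≤ k≤
      ⊳ readLiteral-prints l₃ x n≤ j≤ k≤
      ⊳ pushed (λ _ → refl))
      (readClauses k cs (suc j) n≤ j+k≤)
    where
    e₁ = enc literalCode l₁
    e₂ = enc literalCode l₂
    e₃ = enc literalCode l₃
    x = enc (vecCode clauseCode) cs
    j≤ : j ≤ B
    j≤ = ≤-trans (m≤n⇒m≤1+n (m≤m+n j k)) j+k≤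
    k≤ : k ≤ B
    k≤ = ≤-trans (m≤n⇒m≤1+n (m≤n+m k j)) j+k≤
    split : (e₁ ++ e₂ ++ e₃ ++ []) ++ x ≡ e₁ ++ e₂ ++ e₃ ++ x
    split = trans (++-assoc e₁ _ x) (cong (e₁ ++_)
      (trans (++-assoc e₂ _ x) (cong (e₂ ++_) (++-assoc e₃ [] x))))

  printVars : ∀ {x m} → m ≤ B → ∀ r i → i + r ≤ B →
    Loops r (cell xsAfter) isTrue printVar (st x i r 0 m) (st x (i + r) 0 0 m)
      (rows r (λ _ → varRows m) i)
  printVars _ zero i _ rewrite +-identityʳ i = stop λ _ → refl
  printVars {x} {m} m≤ (suc r) i i+r≤ rewrite +-suc i r =
    again (λ _ → refl)
      (popped {A′ = st x i r 0 m} (λ _ → refl) ⊳ row (varText true false)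
        ⊳ row (varText false true) ⊳ row (varText true true) ⊳ pushed (λ _ → refl))
      (printVars m≤ r (suc i) i+r≤)
    where
    row : ∀ T → Prints (print T) (st x i r 0 m) (st x i r 0 m) (text T i r 0 m)
    row T = print-prints T (≤-trans (m≤n⇒m≤1+n (m≤m+n i r)) i+r≤)
      (≤-trans (m≤n⇒m≤1+n (m≤n+m r i)) i+r≤) z≤n m≤

  translate-prints : ∀ φ → let open Formula φ in #vars ≤ B → #clauses ≤ B →
    Prints translate (st (enc formulaCode φ) 0 0 0 0) (st [] 0 #vars #clauses 0) (output φ)
  translate-prints (formula n m cs) n≤ m≤ =
    looped n≤ (countdown (λ k l → st (unary k ++ unary m ++ x) 0 l 0 0)
      (λ _ _ _ → refl) (λ _ _ → refl)
      (λ _ _ → popped (λ _ → refl) ⊳ pushed (λ _ → refl)) n 0)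
    ⊳ popped {A′ = st (unary m ++ x) 0 n 0 0} (λ _ → refl)
    ⊳ looped m≤ (countdown (λ k l → st (unary k ++ x) 0 n 0 l)
      (λ _ _ _ → refl) (λ _ _ → refl)
      (λ _ _ → popped (λ _ → refl) ⊳ pushed (λ _ → refl)) m 0)
    ⊳ popped {A′ = st x 0 n 0 m} (λ _ → refl)
    ⊳ line (sizeText 2 1) ⊳ line (sizeText 3 3) ⊳ line apexText
    ⊳ looped n≤ (printVars m≤ n 0 n≤)
    ⊳ restore n n≤
    ⊳ looped m≤ (readClauses m cs 0 n≤ m≤)
    ⊳ print-prints (word 00s) z≤n n≤ m≤ z≤n
    where
    x = enc (vecCode clauseCode) cs
    line : ∀ T → Prints (print T) (st x 0 n 0 m) (st x 0 n 0 m) (text T 0 n 0 m)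
    line T = print-prints T z≤n n≤ z≤n m≤

-- Each bit costs two tests, a pop and a push. The iterations are counted by the output, whose
-- length may exceed that of the input.
reverse-⇓ : ∀ o {x n m} →
  ⟨ reverseOut , st x 0 n m 0 o ⟩⇓[ 1 + length o * 4 ] st (o ʳ++ x) 0 n m 0 []
reverse-⇓ []          = exit⇓ refl
reverse-⇓ (true ∷ o)  = repeat⇓ refl (then⇓ refl (seq⇓ pop⇓ push⇓)) (reverse-⇓ o)
reverse-⇓ (false ∷ o) = repeat⇓ refl (else⇓ refl (seq⇓ pop⇓ push⇓)) (reverse-⇓ o)

-- The output is the encoding of the hypergraph

module _ {A : Set} (c : Code A) where

  encVec-++ : ∀ {m n} (u : Vec A m) (v : Vec A n) →
              encVec c (u Vec.++ v) ≡ encVec c u ++ encVec c v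
  encVec-++ []      v = refl
  encVec-++ (x ∷ u) v = trans (cong (enc c x ++_) (encVec-++ u v))
    (sym (++-assoc (enc c x) (encVec c u) (encVec c v)))

  -- The offset `j` is arbitrary for the induction, as `rows` counts upwards from it.
  encVec-concat-tabulate : ∀ k {m} (f : Fin k → Vec A m) g j →
    (∀ i → encVec c (f i) ≡ g i (j + toℕ i) (k ∸ suc (toℕ i))) →
    encVec c (concat (tabulate f)) ≡ rows k g j
  encVec-concat-tabulate zero    f g j _  = refl
  encVec-concat-tabulate (suc k) f g j eq = trans (encVec-++ (f zero) _) (cong₂ _++_
    (trans (eq zero) (cong (λ l → g zero l k) (+-identityʳ j)))
    (encVec-concat-tabulate k (f ∘ suc) (g ∘ suc) (suc j)
      λ i → trans (eq (suc i)) (cong (λ l → g (suc i) l (k ∸ suc (toℕ i))) (+-suc j (toℕ i)))))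

bits-of : ∀ {n} → Vec Bool n → List Bool
bits-of = encVec bitCode

bits-replicate : ∀ m b → bits-of (Vec.replicate m b) ≡ m ×̇ [ b ]
bits-replicate zero    b = refl
bits-replicate (suc m) b = cong (b ∷_) (bits-replicate m b)

bits-⊥ : ∀ n {m} (w : Vec Bool m) → bits-of (⊥ {n * 2} Vec.++ w) ≡ n ×̇ 00s ++ bits-of w
bits-⊥ zero    w = refl
bits-⊥ (suc n) w = cong (00s ++_) (bits-⊥ n w)

bits-⁅⁆ : ∀ {m} (j : Fin m) →
          bits-of ⁅ j ⁆ ≡ toℕ j ×̇ [ false ] ++ true ∷ (m ∸ suc (toℕ j)) ×̇ [ false ]
bits-⁅⁆ {suc m} zero    = cong (true ∷_) (bits-replicate m false)
bits-⁅⁆ {suc m} (suc j) = cong (false ∷_) (bits-⁅⁆ j)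

-- The literal part of a row that meets only the two literals of variable `i`; it describes unit,
-- pair and link edges alike.
block : ∀ {n} → Bool → Bool → Fin n → Subset (n * 2)
block p q zero    = p ∷ q ∷ ⊥
block p q (suc i) = false ∷ false ∷ block p q i

bits-block : ∀ {n m} p q (i : Fin n) (w : Vec Bool m) →
  bits-of (block p q i Vec.++ w) ≡
  toℕ i ×̇ 00s ++ p ∷ q ∷ (n ∸ suc (toℕ i)) ×̇ 00s ++ bits-of w
bits-block {suc n} p q zero    w = cong (λ l → p ∷ q ∷ l) (bits-⊥ n w)
bits-block {suc n} p q (suc i) w = cong (00s ++_) (bits-block p q i w)

block-∪ : ∀ {n} p q r s (i : Fin n) → block p q i ∪ block r s i ≡ block (p ∨ r) (q ∨ s) i
block-∪ p q r s zero    = cong (λ l → _ ∷ _ ∷ l) (∪-idem ⊥)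
block-∪ p q r s (suc i) = cong (λ l → false ∷ false ∷ l) (block-∪ p q r s i)

⁅combine⁆ : ∀ {n} b (i : Fin n) → ⁅ combine i (side b) ⁆ ≡ block b (not b) i
⁅combine⁆ true  zero    = refl
⁅combine⁆ false zero    = refl
⁅combine⁆ b     (suc i) = cong (λ l → false ∷ false ∷ l) (⁅combine⁆ b i)

⁅↑ˡ⁆ : ∀ {n} m (i : Fin n) → ⁅ i ↑ˡ m ⁆ ≡ ⁅ i ⁆ Vec.++ ⊥
⁅↑ˡ⁆ {suc n} m zero    = cong (true ∷_) (⊥-++ n)
  where
  ⊥-++ : ∀ n → ⊥ ≡ ⊥ {n} Vec.++ ⊥ {m}
  ⊥-++ zero    = refl
  ⊥-++ (suc n) = cong (false ∷_) (⊥-++ n)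
⁅↑ˡ⁆ m (suc i) = cong (false ∷_) (⁅↑ˡ⁆ m i)

⁅↑ʳ⁆ : ∀ n {m} (j : Fin m) → ⁅ n ↑ʳ j ⁆ ≡ ⊥ {n} Vec.++ ⁅ j ⁆
⁅↑ʳ⁆ zero    j = refl
⁅↑ʳ⁆ (suc n) j = cong (false ∷_) (⁅↑ʳ⁆ n j)

×̇-ones : ∀ k a b → k ×̇ ones a ++ unary b ≡ unary (k * a + b)
×̇-ones zero    a b = refl
×̇-ones (suc k) a b = trans (++-assoc (ones a) (k ×̇ ones a) (unary b))
  (trans (cong (ones a ++_) (×̇-ones k a b))
    (trans (ones-unary a (k * a + b)) (cong unary (sym (+-assoc a (k * a) b)))))
  where
  ones-unary : ∀ a b → ones a ++ unary b ≡ unary (a + b)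
  ones-unary zero    b = refl
  ones-unary (suc a) b = cong (true ∷_) (ones-unary a b)

sizeText-unary : ∀ n m a b → text (sizeText a b) 0 n 0 m ≡ unary (suc (n * a + m * b))
sizeText-unary n m a b = cong (true ∷_) (trans
  (cong (n ×̇ ones a ++_) (trans (×̇-ones m b 0) (cong unary (+-identityʳ (m * b)))))
  (×̇-ones n a (m * b)))

module _ (φ : Formula) where
  open Formula φ renaming (#vars to n; #clauses to m)
  open Reduction φ hiding (pt)

  opaque
    unfolding Reduction.pt

    lit-block : ∀ b (i : Fin n) → ⟨ lit (b , i) ⟩ ≡ false ∷ (block b (not b) i Vec.++ ⊥)
    lit-block b i = cong (false ∷_) (trans (⁅↑ˡ⁆ m (combine i (side b)))
      (cong (Vec._++ ⊥) (⁅combine⁆ b i)))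

    cls-block : ∀ j → ⟨ cls j ⟩ ≡ false ∷ (⊥ {n * 2} Vec.++ ⁅ j ⁆)
    cls-block j = cong (false ∷_) (⁅↑ʳ⁆ (n * 2) j)

    -- True by `refl` only where `pt` is unfolded; outside this block the equation has to be cited.
    ⟨∣⟩-∪ : ∀ x y → ⟨ x ∣ y ⟩ ≡ ⟨ x ⟩ ∪ ⟨ y ⟩
    ⟨∣⟩-∪ x y = refl

    bits-apex : bits-of apexEdge ≡ text apexText 0 n 0 m
    bits-apex = cong (true ∷_) (trans (bits-⊥ n ⊤) (cong (n ×̇ 00s ++_) (bits-replicate m true)))

  bits-block-⊥ : ∀ p q (i : Fin n) → bits-of (false ∷ (block p q i Vec.++ ⊥ {m})) ≡
                 text (varText p q) (toℕ i) (n ∸ suc (toℕ i)) 0 m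
  bits-block-⊥ p q i = cong (false ∷_) (trans (bits-block p q i ⊥)
    (cong (λ l → toℕ i ×̇ 00s ++ p ∷ q ∷ (n ∸ suc (toℕ i)) ×̇ 00s ++ l) (bits-replicate m false)))

  bits-unit : ∀ b i → bits-of (unitEdge (b , i)) ≡
              text (varText b (not b)) (toℕ i) (n ∸ suc (toℕ i)) 0 m
  bits-unit b i = trans (cong bits-of (lit-block b i)) (bits-block-⊥ b (not b) i)

  bits-pair : ∀ i → bits-of (pairEdge i) ≡ text (varText true true) (toℕ i) (n ∸ suc (toℕ i)) 0 m
  bits-pair i = trans (cong bits-of eq) (bits-block-⊥ true true i)
    where
    open ≡-Reasoning
    eq : pairEdge i ≡ false ∷ (block true true i Vec.++ ⊥ {m})
    eq = begin
      ⟨ lit (true , i) ∣ lit (false , i) ⟩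
        ≡⟨ ⟨∣⟩-∪ _ _ ⟩
      ⟨ lit (true , i) ⟩ ∪ ⟨ lit (false , i) ⟩
        ≡⟨ cong₂ _∪_ (lit-block true i) (lit-block false i) ⟩
      false ∷ ((block true false i Vec.++ ⊥ {m}) ∪ (block false true i Vec.++ ⊥ {m}))
        ≡⟨ cong (false ∷_) (zipWith-++ _ (block true false i) (⊥ {m}) (block false true i) ⊥) ⟩
      false ∷ ((block true false i ∪ block false true i) Vec.++ (⊥ {m} ∪ ⊥))
        ≡⟨ cong₂ (λ p q → false ∷ (p Vec.++ q))
             (block-∪ true false false true i) (∪-idem (⊥ {m})) ⟩
      false ∷ (block true true i Vec.++ ⊥ {m}) ∎

  bits-link : ∀ j l → bits-of (linkEdge j l) ≡ literalRow l (toℕ j) (m ∸ suc (toℕ j))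
  bits-link j (b , i) = trans (cong bits-of eq) (cong (false ∷_)
    (trans (bits-block b (not b) i ⁅ j ⁆)
      (cong (λ l → toℕ i ×̇ 00s ++ b ∷ not b ∷ (n ∸ suc (toℕ i)) ×̇ 00s ++ l) (bits-⁅⁆ j))))
    where
    open ≡-Reasoning
    eq : linkEdge j (b , i) ≡ false ∷ (block b (not b) i Vec.++ ⁅ j ⁆)
    eq = begin
      ⟨ lit (b , i) ∣ cls j ⟩
        ≡⟨ ⟨∣⟩-∪ _ _ ⟩
      ⟨ lit (b , i) ⟩ ∪ ⟨ cls j ⟩
        ≡⟨ cong₂ _∪_ (lit-block b i) (cls-block j) ⟩
      false ∷ ((block b (not b) i Vec.++ ⊥ {m}) ∪ (⊥ {n * 2} Vec.++ ⁅ j ⁆))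
        ≡⟨ cong (false ∷_) (zipWith-++ _ (block b (not b) i) (⊥ {m}) ⊥ ⁅ j ⁆) ⟩
      false ∷ ((block b (not b) i ∪ ⊥) Vec.++ (⊥ ∪ ⁅ j ⁆))
        ≡⟨ cong₂ (λ p q → false ∷ (p Vec.++ q))
             (∪-identityʳ (block b (not b) i)) (∪-identityˡ ⁅ j ⁆) ⟩
      false ∷ (block b (not b) i Vec.++ ⁅ j ⁆) ∎

  rowCode : Code (Subset #V)
  rowCode = vecCode bitCode

  bits-clause : ∀ j (c : Clause n) →
    encVec rowCode (Vec.map (linkEdge j) c) ≡ clauseRows c (toℕ j) (m ∸ suc (toℕ j))
  bits-clause j (l₁ ∷ l₂ ∷ l₃ ∷ []) =
    cong₂ _++_ (bits-link j l₁) (cong₂ _++_ (bits-link j l₂) (cong₂ _++_ (bits-link j l₃) refl))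

  encode-image : Problem.encode MinCoreRadius image ≡ output φ
  encode-image = begin
    (unary #V ++ unary (suc (n * 3 + m * 3)) ++ encVec rowCode (Hypergraph.edges H)) ++ 00s
      ≡⟨ ++-assoc (unary #V) _ 00s ⟩
    unary #V ++ (unary (suc (n * 3 + m * 3)) ++ encVec rowCode (Hypergraph.edges H)) ++ 00s
      ≡⟨ cong (unary #V ++_) (++-assoc (unary (suc (n * 3 + m * 3))) _ 00s) ⟩
    unary #V ++ unary (suc (n * 3 + m * 3))
      ++ (bits-of apexEdge ++ encVec rowCode (vs Vec.++ cs)) ++ 00s
      ≡⟨ cong₂ (λ u v → u ++ v ++ (bits-of apexEdge ++ encVec rowCode (vs Vec.++ cs)) ++ 00s)
           #V-text (sym (sizeText-unary n m 3 3)) ⟩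
    text (sizeText 2 1) 0 n 0 m ++ text (sizeText 3 3) 0 n 0 m
      ++ (bits-of apexEdge ++ encVec rowCode (vs Vec.++ cs)) ++ 00s
      ≡⟨ cong (λ w → text (sizeText 2 1) 0 n 0 m ++ text (sizeText 3 3) 0 n 0 m ++ w) edges-text ⟩
    output φ ∎
    where
    open ≡-Reasoning
    vs = concat (tabulate varEdges)
    cs = concat (tabulate clauseEdges)
    #V-text : unary #V ≡ text (sizeText 2 1) 0 n 0 m
    #V-text = trans (cong (λ k → unary (suc (n * 2 + k))) (sym (*-identityʳ m)))
      (sym (sizeText-unary n m 2 1))
    edges-text : (bits-of apexEdge ++ encVec rowCode (vs Vec.++ cs)) ++ 00s ≡
      text apexText 0 n 0 m ++ rows n (λ _ → varRows m) 0
        ++ rows m (clauseRows ∘ lookup clauses) 0 ++ 00s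
    edges-text = begin
      (bits-of apexEdge ++ encVec rowCode (vs Vec.++ cs)) ++ 00s
        ≡⟨ ++-assoc (bits-of apexEdge) _ 00s ⟩
      bits-of apexEdge ++ encVec rowCode (vs Vec.++ cs) ++ 00s
        ≡⟨ cong (λ w → bits-of apexEdge ++ w ++ 00s) (encVec-++ rowCode vs cs) ⟩
      bits-of apexEdge ++ (encVec rowCode vs ++ encVec rowCode cs) ++ 00s
        ≡⟨ cong (bits-of apexEdge ++_) (++-assoc (encVec rowCode vs) _ 00s) ⟩
      bits-of apexEdge ++ encVec rowCode vs ++ encVec rowCode cs ++ 00s
        ≡⟨ cong₂ _++_ bits-apex (cong₂ (λ u v → u ++ v ++ 00s)
             (encVec-concat-tabulate rowCode n varEdges (λ _ → varRows m) 0 λ i →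
               cong₂ _++_ (bits-unit true i) (cong₂ _++_ (bits-unit false i)
                 (cong₂ _++_ (bits-pair i) refl)))
             (encVec-concat-tabulate rowCode m clauseEdges (clauseRows ∘ lookup clauses) 0 λ j →
               bits-clause j (lookup clauses j))) ⟩
      _ ∎

-- The polynomial bound and the reduction

length-unary-++ : ∀ n x → n ≤ length (unary n ++ x)
length-unary-++ zero    x = z≤n
length-unary-++ (suc n) x = s≤s (length-unary-++ n x)

open Reduction using (image; correct)

opaque

  -- The second summand bounds the reversal of at most `cost translate B` bits. Opacity keeps the
  -- exponent from being evaluated.
  totalCost : PolyBounded λ B → cost translate B + (1 + cost translate B * 4)
  totalCost = poly-+ (cost-poly translate)
    (poly-+ poly-1 (poly-* (cost-poly translate) (poly-const 4)))

-- The loop bound `B` is the length of the input, which exceeds both sizes since they are written in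
-- unary.
polyTime : PolyTime ThreeSAT MinCoreRadius image
polyTime = 6 , translate ⨾ reverseOut , 3 ^ proj₁ totalCost , proj₁ totalCost , λ φ →
  let open Formula φ renaming (#vars to n; #clauses to m)
      x = enc formulaCode φ
      T = output φ
      n≤ : n ≤ length x
      n≤ = length-unary-++ n _
      m≤ : m ≤ length x
      m≤ = ≤-trans (length-unary-++ m _)
        (≤-trans (m≤n+m _ _) (≤-reflexive (sym (length-++ (unary n)))))
      t , t≤ , translate⇓ = Run.Prints.runs (translate-prints φ n≤ m≤) []
      printed≤ : length (T ʳ++ []) ≤ cost translate (length x)
      printed≤ = ≤-trans (length-⇓-≤ translate⇓ out) (≤-trans (≤-reflexive (+-identityʳ t)) t≤)
  in t + (1 + length (T ʳ++ []) * 4)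
   , ≤-trans (+-mono-≤ t≤ (s≤s (*-monoˡ-≤ 4 printed≤)))
       (≤-trans (proj₂ totalCost (length x)) ([2+n]^d≤ (length x) (proj₁ totalCost)))
   , _ , seq⇓ translate⇓ (reverse-⇓ (T ʳ++ []))
   -- The text was stacked with its last bit on top, so reversing it onto the emptied input stack
   -- gives `T` itself.
   , trans (ʳ++-ʳ++ T) (trans (++-identityʳ T) (sym (encode-image φ)))

theorem3 : ThreeSAT ≤ₚ MinCoreRadius
theorem3 = image , polyTime , correct
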